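{- Let $b\ge 2$ be an integer and let $w$ be a fixed block of $b$-ary digits of length $p\ge1$. For each integer $k\ge 0$ let $\mu_k$ be the discrete measure on $[0,1)$ $$\mu_k=\sum_{X:\,k_w(X)=k} b^{ -|X|}\,\delta_{x(X)},$$ where the sum is over all finite strings $X$ of $b$-ary digits (the empty string included) with $k_w(X)=k$. Then, as $k\to\infty$, $\mu_k$ converges weakly to $b^p$ times Lebesgue measure on $[0,1)$. Precisely, for every interval $I\subset[0,1)$, $$\lim_{k\to\infty}\mu_k(I)=b^p\,|I|,$$ where $|I|=\sup I-\inf I$.
   Context: Strings are finite sequences over the alphabet $\{0,1,\dots,b-1\}$, including the empty string $\epsilon$. The length of a string $X$ is $|X|$. For a string $X$, $n(X)$ is the non-negative integer it represents in base $b$ (left-to-right positional notation), with $n(\epsilon)=0$, and $x(X)=n(X)/b^{|X|}\in[0,1)$. $k_w(X)$ is the number of occurrences of $w$ in $X$, counting possibly overlapping occurrences: indices $i$ with $x_i\dots x_{i+p-1}=w$. $\delta_y$ denotes the Dirac mass at $y$. -}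

module Defs where

open import Level using (0ℓ)
open import Data.Nat as ℕ using (ℕ; NonTrivial; nonTrivial⇒nonZero)
import Data.Nat.Properties as ℕ
open import Data.Integer using (+_)
open import Data.Rational
import Data.Rational.Properties as ℚ
open import Data.Rational.Solver using (module +-*-Solver)
open import Data.Fin as Fin using (Fin; toℕ)
import Data.Fin.Properties as Fin
open import Data.List using (List; length; map; foldr; foldl; filter; take; drop; upTo)
open import Data.List.Properties using (≡-dec)
open import Data.List.Relation.Unary.All using (All)
open import Data.List.Relation.Unary.Unique.Propositional using (Unique)
open import Data.Vec using (Vec; toList)
open import Data.Product using (∃-syntax; _×_; _,_)
open import Relation.Unary using (Pred; _∈_)
open import Relation.Binary.PropositionalEquality using (_≡_; refl; sym; trans; cong; subst)

-- Real numbers as Cauchy sequences of rationals.  Two sequences with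
-- x ≤ᴿ y and y ≤ᴿ x are the same real number.

record ℝ : Set where
  field
    seq    : ℕ → ℚ
    cauchy : ∀ ε → 0ℚ < ε →
             ∃[ N ] (∀ m n → N ℕ.≤ m → N ℕ.≤ n → ∣ seq m - seq n ∣ < ε)

open ℝ public

infix 4 _<ᴿ_ _≤ᴿ_

_<ᴿ_ : ℝ → ℝ → Set
x <ᴿ y = ∃[ ε ] (0ℚ < ε × ∃[ N ] (∀ n → N ℕ.≤ n → seq x n + ε < seq y n))

_≤ᴿ_ : ℝ → ℝ → Set
x ≤ᴿ y = ∀ ε → 0ℚ < ε → ∃[ N ] (∀ n → N ℕ.≤ n → seq x n < seq y n + ε)

fromℚ : ℚ → ℝ
fromℚ q .seq _ = q
fromℚ q .cauchy ε 0<ε =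
  0 , λ _ _ _ _ → subst (λ r → ∣ r ∣ < ε) (sym (ℚ.+-inverseʳ q)) 0<ε

private
  half-pos : ∀ {ε} → 0ℚ < ε → 0ℚ < ½ * ε
  half-pos = ℚ.*-monoʳ-<-pos ½

  half+half : ∀ ε → ½ * ε + ½ * ε ≡ ε
  half+half ε = trans (sym (ℚ.*-distribʳ-+ ε ½ ½)) (ℚ.*-identityˡ ε)

infixl 6 _+ᴿ_ _-ᴿ_
infix  8 -ᴿ_
infixl 7 _·_

_+ᴿ_ : ℝ → ℝ → ℝ
(x +ᴿ y) .seq n = seq x n + seq y n
(x +ᴿ y) .cauchy ε 0<ε
  with M , x< ← x .cauchy (½ * ε) (half-pos 0<ε)
     | N , y< ← y .cauchy (½ * ε) (half-pos 0<ε) =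
  M ℕ.⊔ N , λ m n M⊔N≤m M⊔N≤n →
    let open ℚ.≤-Reasoning in begin-strict
      ∣ (seq x m + seq y m) - (seq x n + seq y n) ∣
        ≡⟨ cong ∣_∣ (rearrange (seq x m) (seq y m) (seq x n) (seq y n)) ⟩
      ∣ (seq x m - seq x n) + (seq y m - seq y n) ∣
        ≤⟨ ℚ.∣p+q∣≤∣p∣+∣q∣ (seq x m - seq x n) (seq y m - seq y n) ⟩
      ∣ seq x m - seq x n ∣ + ∣ seq y m - seq y n ∣
        <⟨ ℚ.+-mono-<
             (x< m n (ℕ.m⊔n≤o⇒m≤o M N M⊔N≤m) (ℕ.m⊔n≤o⇒m≤o M N M⊔N≤n))
             (y< m n (ℕ.m⊔n≤o⇒n≤o M N M⊔N≤m) (ℕ.m⊔n≤o⇒n≤o M N M⊔N≤n)) ⟩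
      ½ * ε + ½ * ε
        ≡⟨ half+half ε ⟩
      ε ∎
  where
  open +-*-Solver
  rearrange : ∀ a b c d → (a + b) - (c + d) ≡ (a - c) + (b - d)
  rearrange = solve 4 (λ a b c d → (a :+ b) :- (c :+ d) := (a :- c) :+ (b :- d)) refl

-ᴿ_ : ℝ → ℝ
(-ᴿ x) .seq n = - seq x n
(-ᴿ x) .cauchy ε 0<ε with N , x< ← x .cauchy ε 0<ε =
  N , λ m n N≤m N≤n →
    subst (_< ε) (cong ∣_∣ (swap (seq x n) (seq x m))) (x< n m N≤n N≤m)
  where
  open +-*-Solver
  swap : ∀ a b → a - b ≡ - b - - a
  swap = solve 2 (λ a b → a :- b := :- b :- :- a) refl

_-ᴿ_ : ℝ → ℝ → ℝ
x -ᴿ y = x +ᴿ (-ᴿ y)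

_·_ : ℚ → ℝ → ℝ
(c · x) .seq n = c * seq x n
(c · x) .cauchy ε 0<ε = scaled (x .cauchy (1/d * ε) 0<ε/d)
  where
  d : ℚ
  d = 1ℚ + ∣ c ∣

  instance
    d-pos : Positive d
    d-pos = ℚ.pos+nonNeg⇒pos 1ℚ (∣ c ∣) {{ℚ.∣-∣-nonNeg c}}

    d-nonZero : NonZero d
    d-nonZero = ℚ.pos⇒nonZero d

  1/d : ℚ
  1/d = 1/ d

  0<ε/d : 0ℚ < 1/d * ε
  0<ε/d = subst (_< 1/d * ε) (ℚ.*-zeroʳ 1/d)
            (ℚ.*-monoʳ-<-pos 1/d {{ℚ.1/pos⇒pos d}} 0<ε)

  open +-*-Solver
  factor : ∀ a b e → a * b - a * e ≡ a * (b - e)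
  factor = solve 3 (λ a b e → a :* b :- a :* e := a :* (b :- e)) refl

  scaled : ∃[ N ] (∀ m n → N ℕ.≤ m → N ℕ.≤ n → ∣ seq x m - seq x n ∣ < 1/d * ε) →
           ∃[ N ] (∀ m n → N ℕ.≤ m → N ℕ.≤ n → ∣ c * seq x m - c * seq x n ∣ < ε)
  scaled (N , x<) = N , λ m n N≤m N≤n →
    let open ℚ.≤-Reasoning
        δ = seq x m - seq x n
    in begin-strict
      ∣ c * seq x m - c * seq x n ∣ ≡⟨ cong ∣_∣ (factor c (seq x m) (seq x n)) ⟩
      ∣ c * δ ∣                     ≡⟨ ℚ.∣p*q∣≡∣p∣*∣q∣ c δ ⟩
      ∣ c ∣ * ∣ δ ∣                 ≡⟨ ℚ.+-identityˡ (∣ c ∣ * ∣ δ ∣) ⟨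
      0ℚ + ∣ c ∣ * ∣ δ ∣            ≤⟨ ℚ.+-monoˡ-≤ (∣ c ∣ * ∣ δ ∣) (ℚ.0≤∣p∣ δ) ⟩
      ∣ δ ∣ + ∣ c ∣ * ∣ δ ∣         ≡⟨ cong (_+ ∣ c ∣ * ∣ δ ∣) (ℚ.*-identityˡ (∣ δ ∣)) ⟨
      1ℚ * ∣ δ ∣ + ∣ c ∣ * ∣ δ ∣    ≡⟨ ℚ.*-distribʳ-+ (∣ δ ∣) 1ℚ (∣ c ∣) ⟨
      d * ∣ δ ∣                     <⟨ ℚ.*-monoʳ-<-pos d (x< m n N≤m N≤n) ⟩
      d * (1/d * ε)                 ≡⟨ ℚ.*-assoc d 1/d ε ⟨
      (d * 1/d) * ε                 ≡⟨ cong (_* ε) (ℚ.*-inverseʳ d) ⟩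
      1ℚ * ε                        ≡⟨ ℚ.*-identityˡ ε ⟩
      ε ∎

IsInterval : Pred ℝ 0ℓ → Set
IsInterval I = ∀ {x y z} → x ∈ I → z ∈ I → x ≤ᴿ y → y ≤ᴿ z → y ∈ I

WithinUnit : Pred ℝ 0ℓ → Set
WithinUnit I = ∀ {x} → x ∈ I → fromℚ 0ℚ ≤ᴿ x × x <ᴿ fromℚ 1ℚ

-- The approximation form of "least" makes suprema and infima constructively
-- usable; classically it is the usual definition for nonempty sets.

IsSup IsInf : Pred ℝ 0ℓ → ℝ → Set
IsSup I s = (∀ {x} → x ∈ I → x ≤ᴿ s) × (∀ t → t <ᴿ s → ∃[ x ] (x ∈ I × t <ᴿ x))
IsInf I i = (∀ {x} → x ∈ I → i ≤ᴿ x) × (∀ t → i <ᴿ t → ∃[ x ] (x ∈ I × x <ᴿ t))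

-- A measure takes values in [0, ∞], and which atoms lie in a given set need not
-- be decidable, so the values are lower reals: v is given by {q ∈ ℚ ∣ q < v},
-- with v = +∞ when this is all of ℚ.

record LowerReal : Set₁ where
  field
    below   : Pred ℚ 0ℓ
    closed  : ∀ {p q} → p < q → q ∈ below → p ∈ below
    rounded : ∀ {p} → p ∈ below → ∃[ q ] (p < q × q ∈ below)

open LowerReal public

-- The (unordered) sum of a nonnegative family f over {a ∣ P a}, that is, the
-- supremum of its finite partial sums.

∑ : {A : Set} → Pred A 0ℓ → (A → ℚ) → LowerReal
∑ P f .below q =
  ∃[ as ] (Unique as × All P as × q < foldr _+_ 0ℚ (map f as))
∑ P f .closed p<q (as , u , ps , q<Σ) = as , u , ps , ℚ.<-trans p<q q<Σ
∑ P f .rounded (as , u , ps , p<Σ) with q , p<q , q<Σ ← ℚ.<-dense p<Σ =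
  q , p<q , as , u , ps , q<Σ

-- The two inner conditions say  l - ε < v k  and  v k ≤ l + ε.

_⟶_ : (ℕ → LowerReal) → ℝ → Set
v ⟶ l = ∀ ε → 0ℚ < ε → ∃[ K ] (∀ k → K ℕ.≤ k →
    (∃[ q ] (q ∈ below (v k) × l -ᴿ fromℚ ε <ᴿ fromℚ q))
  × (∀ q → q ∈ below (v k) → fromℚ q ≤ᴿ l +ᴿ fromℚ ε))

module _ (b : ℕ) where

  Str : Set
  Str = List (Fin b)

  n⟨_⟩ : Str → ℕ
  n⟨_⟩ = foldl (λ n d → n ℕ.* b ℕ.+ toℕ d) 0

  occurrences : ∀ {p} → Vec (Fin b) p → Str → ℕ
  occurrences {p} w X =
    length (filter (λ i → ≡-dec Fin._≟_ (take p (drop i X)) (toList w))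
                   (upTo (length X)))

  module _ .{{_ : NonTrivial b}} where

    _/b^_ : ℕ → ℕ → ℚ
    m /b^ n = (+ m / (b ℕ.^ n)) {{ℕ.m^n≢0 b n {{nonTrivial⇒nonZero b}}}}

    x⟨_⟩ : Str → ℚ
    x⟨ X ⟩ = n⟨ X ⟩ /b^ length X

    weight : Str → ℚ
    weight X = 1 /b^ length X

    -- μ w k I  is  μ_k(I) = Σ { b^{-|X|} ∣ k_w(X) = k, x(X) ∈ I }.
    μ : ∀ {p} → Vec (Fin b) p → ℕ → Pred ℝ 0ℓ → LowerReal
    μ w k I = ∑ (λ X → occurrences w X ≡ k × fromℚ x⟨ X ⟩ ∈ I) weight

{-# OPTIONS --safe #-}

-- Read the digits as independent and uniform, so that Σ b^{-|Z|} [k_w(YZ) = k] is the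
-- expected number of lengths at which the running count of w in Y Z₁ Z₂ … equals k.
-- Once an occurrence has just been completed this expectation is b^p: averaging over
-- the state (the last p - 1 letters), which has the uniform distribution at all times,
-- one step of the chain changes the average only through the transition that completes
-- w, of probability b^{-p}.  Hence, for k > m, μ_k gives mass exactly b^p b^{-m} to
-- every b-adic interval of length b^{-m}, up to a truncation error governed by the
-- probability of seeing few occurrences in a long word.  An interval I is then
-- squeezed between unions of consecutive b-adic intervals.

module Submission where

open import Defs
open import Level using (0ℓ)
open import Data.Nat using (ℕ; _^_; NonZero; NonTrivial)
open import Data.Integer using (+_)
open import Data.Rational using (_/_)
open import Data.Fin using (Fin)
open import Data.Vec using (Vec)
open import Relation.Unary using (Pred)

open import Data.Bool using (if_then_else_; true; false)
open import Data.Empty using (⊥)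
open import Data.Fin as Fin using (toℕ)
import Data.Fin.Properties as Fin
import Data.Integer as ℤ
import Data.Integer.Properties as ℤ
open import Data.List
  using ( List; []; _∷_; _++_; _∷ʳ_; length; map; foldr; foldl; take; drop; filter; concat
        ; allFin; upTo; applyUpTo; cartesianProductWith; initLast; _∷ʳ′_)
import Data.List.Properties as List
open import Data.List.Properties using (≡-dec)
open import Data.List.Membership.Propositional using () renaming (_∈_ to _∈ₗ_)
import Data.List.Membership.Propositional.Properties as Mem
open import Data.List.Relation.Unary.All as All using (All; []; _∷_)
import Data.List.Relation.Unary.All.Properties as All
open import Data.List.Relation.Unary.AllPairs using ([]; _∷_)
import Data.List.Relation.Unary.AllPairs.Properties as AllPairs
open import Data.List.Relation.Unary.Any using (here; there)
open import Data.List.Relation.Unary.Unique.Propositional using (Unique)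
import Data.List.Relation.Unary.Unique.Propositional.Properties as Unique
open import Data.Nat as ℕ using (zero; suc; z≤n; s≤s; nonTrivial⇒nonZero; nonTrivial⇒n>1)
import Data.Nat.Properties as ℕ
open import Data.Nat.Divisibility using (divides-refl)
open import Data.Nat.DivMod
  using ( _mod_; m≡m%n+[m/n]*n; [m+kn]%n≡m%n; m<n⇒m%n≡m; m*n/n≡m; +-distrib-/-∣ʳ; m<n⇒m/n≡0
        ; m<n*o⇒m/o<n; m%n<n)
import Data.Nat.Tactic.RingSolver as ℕ-Solver
open import Data.Product using (∃-syntax; _×_; _,_; proj₁; proj₂)
open import Data.Rational hiding (NonZero)
import Data.Rational.Properties as ℚ
import Data.Rational.Unnormalised as ℚᵘ
import Data.Rational.Unnormalised.Properties as ℚᵘ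
open import Data.Sum using (inj₁; inj₂)
open import Data.Vec as Vec using (toList)
import Data.Vec.Properties as Vec
open import Function using (_∘_)
open import Relation.Binary.PropositionalEquality
open import Relation.Nullary using (Dec; yes; no; contradiction; does)
open import Relation.Nullary.Decidable using (dec⇒maybe; dec-true; dec-false)
open import Relation.Unary using (Decidable; _∈_)
open import Tactic.RingSolver using (solve-∀)
open import Tactic.RingSolver.Core.AlmostCommutativeRing using (AlmostCommutativeRing; fromCommutativeRing)

-- The averaging identity (`renewal`) is kept for an arbitrary function `g` of the count because it
-- is used twice. The indicator `le k` decreases by `eq k` and yields the expected number of lengths
-- at which the count is `k`; the ramp `hinge k` decreases by `le k` and bounds the truncation
-- error. That error decays like 1/L in the truncation length L, which suffices because L may be
-- chosen after `k` and `m`. Lower reals shape the second half: an upper bound has to hold for every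
-- duplicate-free finite list of strings, whereas a lower bound needs one explicit list. The other
-- obstacle is that reals cannot be compared decidably. The end points of I are therefore located on
-- the grid of mesh b^(-m) only up to two cells, and they need not belong to I, so convexity is
-- applied to elements of I close to them. All these losses are bounded multiples of the mass of one
-- cell, and the factor 16 in the choice of `m` pays for them.

private
  ℚ-ring : AlmostCommutativeRing 0ℓ 0ℓ
  ℚ-ring = fromCommutativeRing ℚ.+-*-commutativeRing (λ x → dec⇒maybe (0ℚ ℚ.≟ x))

-- Natural numbers inside the rationals.

ι : ℕ → ℚ
ι n = + n / 1

toℚᵘ-ι : ∀ n → toℚᵘ (ι n) ℚᵘ.≃ ℚᵘ.mkℚᵘ (+ n) 0
toℚᵘ-ι n = ℚ.toℚᵘ-fromℚᵘ (ℚᵘ.mkℚᵘ (+ n) 0)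

ι-+ : ∀ m n → ι (m ℕ.+ n) ≡ ι m + ι n
ι-+ m n = ℚ.toℚᵘ-injective (begin
  toℚᵘ (ι (m ℕ.+ n))                            ≈⟨ toℚᵘ-ι (m ℕ.+ n) ⟩
  ℚᵘ.mkℚᵘ (+ (m ℕ.+ n)) 0                       ≈⟨ ℚᵘ.*≡* (cong (ℤ._* + 1) (cong₂ ℤ._+_ (sym (ℤ.*-identityʳ (+ m))) (sym (ℤ.*-identityʳ (+ n))))) ⟩
  ℚᵘ.mkℚᵘ (+ m) 0 ℚᵘ.+ ℚᵘ.mkℚᵘ (+ n) 0          ≈⟨ ℚᵘ.+-cong (toℚᵘ-ι m) (toℚᵘ-ι n) ⟨
  toℚᵘ (ι m) ℚᵘ.+ toℚᵘ (ι n)                    ≈⟨ ℚ.toℚᵘ-homo-+ (ι m) (ι n) ⟨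
  toℚᵘ (ι m + ι n)                              ∎)
  where open ℚᵘ.≃-Reasoning

ι-* : ∀ m n → ι (m ℕ.* n) ≡ ι m * ι n
ι-* m n = ℚ.toℚᵘ-injective (begin
  toℚᵘ (ι (m ℕ.* n))                            ≈⟨ toℚᵘ-ι (m ℕ.* n) ⟩
  ℚᵘ.mkℚᵘ (+ (m ℕ.* n)) 0                       ≈⟨ ℚᵘ.*≡* (cong (ℤ._* + 1) (ℤ.pos-* m n)) ⟩
  ℚᵘ.mkℚᵘ (+ m) 0 ℚᵘ.* ℚᵘ.mkℚᵘ (+ n) 0          ≈⟨ ℚᵘ.*-cong (toℚᵘ-ι m) (toℚᵘ-ι n) ⟨
  toℚᵘ (ι m) ℚᵘ.* toℚᵘ (ι n)                    ≈⟨ ℚ.toℚᵘ-homo-* (ι m) (ι n) ⟨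
  toℚᵘ (ι m * ι n)                              ∎)
  where open ℚᵘ.≃-Reasoning

/-*-cancel : ∀ m d .{{_ : ℕ.NonZero d}} → (+ m / d) * ι d ≡ ι m
/-*-cancel m (suc d) = ℚ.toℚᵘ-injective (begin
  toℚᵘ ((+ m / suc d) * ι (suc d))              ≈⟨ ℚ.toℚᵘ-homo-* (+ m / suc d) (ι (suc d)) ⟩
  toℚᵘ (+ m / suc d) ℚᵘ.* toℚᵘ (ι (suc d))      ≈⟨ ℚᵘ.*-cong (ℚ.toℚᵘ-fromℚᵘ (ℚᵘ.mkℚᵘ (+ m) d)) (toℚᵘ-ι (suc d)) ⟩
  ℚᵘ.mkℚᵘ (+ m) d ℚᵘ.* ℚᵘ.mkℚᵘ (+ suc d) 0      ≈⟨ ℚᵘ.*≡* (trans (ℤ.*-identityʳ _) (cong (λ e → + m ℤ.* + suc e) (sym (ℕ.*-identityʳ d)))) ⟩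
  ℚᵘ.mkℚᵘ (+ m) 0                               ≈⟨ toℚᵘ-ι m ⟨
  toℚᵘ (ι m)                                    ∎)
  where open ℚᵘ.≃-Reasoning

ι-nonNeg : ∀ n → NonNegative (ι n)
ι-nonNeg n = ℚ.normalize-nonNeg n 1

0≤ι : ∀ n → 0ℚ ≤ ι n
0≤ι n = ℚ.nonNegative⁻¹ (ι n) {{ι-nonNeg n}}

ι-mono-≤ : ∀ {m n} → m ℕ.≤ n → ι m ≤ ι n
ι-mono-≤ {m} {n} m≤n = begin
  ι m                 ≡⟨ ℚ.+-identityʳ (ι m) ⟨
  ι m + 0ℚ            ≤⟨ ℚ.+-monoʳ-≤ (ι m) (0≤ι (n ℕ.∸ m)) ⟩
  ι m + ι (n ℕ.∸ m)   ≡⟨ ι-+ m (n ℕ.∸ m) ⟨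
  ι (m ℕ.+ (n ℕ.∸ m)) ≡⟨ cong ι (ℕ.m+[n∸m]≡n m≤n) ⟩
  ι n                 ∎
  where open ℚ.≤-Reasoning

ι-cancel-< : ∀ {m n} → ι m < ι n → m ℕ.< n
ι-cancel-< ιm<ιn = ℕ.≰⇒> λ n≤m → ℚ.<-irrefl refl (ℚ.<-≤-trans ιm<ιn (ι-mono-≤ n≤m))

ι-pos : ∀ n .{{_ : ℕ.NonZero n}} → Positive (ι n)
ι-pos n = ℚ.normalize-pos n 1

-- Linear arithmetic: a ≤ b is a sum of known inequalities, and the ring solver proves
-- that it has the same difference as the goal.

≤-by : ∀ {a b c d} → b - a ≡ d - c → a ≤ b → c ≤ d
≤-by {a} {b} {c} {d} eq a≤b = begin
  c              ≡⟨ e₁ a c ⟩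
  a + (c - a)    ≤⟨ ℚ.+-monoˡ-≤ (c - a) a≤b ⟩
  b + (c - a)    ≡⟨ e₂ a b c ⟩
  (b - a) + c    ≡⟨ cong (_+ c) eq ⟩
  (d - c) + c    ≡⟨ e₃ c d ⟩
  d              ∎
  where
  open ℚ.≤-Reasoning
  e₁ : ∀ a c → c ≡ a + (c - a)
  e₁ = solve-∀ ℚ-ring
  e₂ : ∀ a b c → b + (c - a) ≡ (b - a) + c
  e₂ = solve-∀ ℚ-ring
  e₃ : ∀ c d → (d - c) + c ≡ d
  e₃ = solve-∀ ℚ-ring

<-by : ∀ {a b c d} → b - a ≡ d - c → a < b → c < d
<-by {a} {b} {c} {d} eq a<b = begin-strict
  c              ≡⟨ e₁ a c ⟩
  a + (c - a)    <⟨ ℚ.+-monoˡ-< (c - a) a<b ⟩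
  b + (c - a)    ≡⟨ e₂ a b c ⟩
  (b - a) + c    ≡⟨ cong (_+ c) eq ⟩
  (d - c) + c    ≡⟨ e₃ c d ⟩
  d              ∎
  where
  open ℚ.≤-Reasoning
  e₁ : ∀ a c → c ≡ a + (c - a)
  e₁ = solve-∀ ℚ-ring
  e₂ : ∀ a b c → b + (c - a) ≡ (b - a) + c
  e₂ = solve-∀ ℚ-ring
  e₃ : ∀ c d → (d - c) + c ≡ d
  e₃ = solve-∀ ℚ-ring

-- Finite sums.

sumOver : {A : Set} → List A → (A → ℚ) → ℚ
sumOver as f = foldr _+_ 0ℚ (map f as)

module _ {A : Set} where

  sumOver-cong : ∀ (as : List A) {f g} → (∀ a → f a ≡ g a) → sumOver as f ≡ sumOver as g
  sumOver-cong as f≗g = cong (foldr _+_ 0ℚ) (List.map-cong f≗g as)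

  sumOver-mono : ∀ (as : List A) {f g} → (∀ a → f a ≤ g a) → sumOver as f ≤ sumOver as g
  sumOver-mono []       f≤g = ℚ.≤-refl
  sumOver-mono (a ∷ as) f≤g = ℚ.+-mono-≤ (f≤g a) (sumOver-mono as f≤g)

  sumOver-++ : ∀ (as bs : List A) f → sumOver (as ++ bs) f ≡ sumOver as f + sumOver bs f
  sumOver-++ []       bs f = sym (ℚ.+-identityˡ _)
  sumOver-++ (a ∷ as) bs f = trans (cong (_+_ (f a)) (sumOver-++ as bs f)) (sym (ℚ.+-assoc (f a) _ _))

  sumOver-map : ∀ {B : Set} (h : B → A) bs f → sumOver (map h bs) f ≡ sumOver bs (f ∘ h)
  sumOver-map h bs f = cong (foldr _+_ 0ℚ) (sym (List.map-∘ bs))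

  sumOver-+ : ∀ (as : List A) f g → sumOver as (λ a → f a + g a) ≡ sumOver as f + sumOver as g
  sumOver-+ []       f g = refl
  sumOver-+ (a ∷ as) f g = trans (cong (_+_ (f a + g a)) (sumOver-+ as f g)) (interchange (f a) (g a) _ _)
    where
    interchange : ∀ x y z u → (x + y) + (z + u) ≡ (x + z) + (y + u)
    interchange = solve-∀ ℚ-ring

  sumOver-* : ∀ c (as : List A) f → sumOver as (λ a → c * f a) ≡ c * sumOver as f
  sumOver-* c []       f = sym (ℚ.*-zeroʳ c)
  sumOver-* c (a ∷ as) f = trans (cong (_+_ (c * f a)) (sumOver-* c as f)) (sym (ℚ.*-distribˡ-+ c (f a) _))

  sumOver-const : ∀ (as : List A) c → sumOver as (λ _ → c) ≡ ι (length as) * c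
  sumOver-const []       c = sym (ℚ.*-zeroˡ c)
  sumOver-const (a ∷ as) c = begin
    c + sumOver as (λ _ → c)     ≡⟨ cong (_+_ c) (sumOver-const as c) ⟩
    c + ι (length as) * c        ≡⟨ e c (ι (length as)) ⟩
    (1ℚ + ι (length as)) * c     ≡⟨ cong (_* c) (ι-+ 1 (length as)) ⟨
    ι (suc (length as)) * c      ∎
    where
    open ≡-Reasoning
    e : ∀ c n → c + n * c ≡ (1ℚ + n) * c
    e = solve-∀ ℚ-ring

sumOver-allFin-suc : ∀ n f → sumOver (allFin (suc n)) f ≡ f Fin.zero + sumOver (allFin n) (f ∘ Fin.suc)
sumOver-allFin-suc n f = cong (_+_ (f Fin.zero))
  (trans (cong (λ as → sumOver as f) (sym (List.map-tabulate {n = n} (λ i → i) Fin.suc)))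
         (sumOver-map Fin.suc (allFin n) f))

sumOver-allFin-point : ∀ {n} (a₀ : Fin n) f c → f a₀ ≡ c → (∀ a → a ≢ a₀ → f a ≡ 0ℚ) →
                       sumOver (allFin n) f ≡ c
sumOver-allFin-point {suc n} Fin.zero f c f≡c f≡0 = begin
  sumOver (allFin (suc n)) f                      ≡⟨ sumOver-allFin-suc n f ⟩
  f Fin.zero + sumOver (allFin n) (f ∘ Fin.suc)   ≡⟨ cong₂ _+_ f≡c (sumOver-cong (allFin n) (λ a → f≡0 (Fin.suc a) (λ ()))) ⟩
  c + sumOver (allFin n) (λ _ → 0ℚ)               ≡⟨ cong (_+_ c) (trans (sumOver-const (allFin n) 0ℚ) (ℚ.*-zeroʳ (ι (length (allFin n))))) ⟩
  c + 0ℚ                                          ≡⟨ ℚ.+-identityʳ c ⟩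
  c                                               ∎
  where open ≡-Reasoning
sumOver-allFin-point {suc n} (Fin.suc a₀) f c f≡c f≡0 = begin
  sumOver (allFin (suc n)) f                      ≡⟨ sumOver-allFin-suc n f ⟩
  f Fin.zero + sumOver (allFin n) (f ∘ Fin.suc)   ≡⟨ cong₂ _+_ (f≡0 Fin.zero (λ ())) (sumOver-allFin-point a₀ (f ∘ Fin.suc) c f≡c (λ a a≢ → f≡0 (Fin.suc a) (a≢ ∘ Fin.suc-injective))) ⟩
  0ℚ + c                                          ≡⟨ ℚ.+-identityˡ c ⟩
  c                                               ∎
  where open ≡-Reasoning

-- Indicators of counts and their discrete antiderivatives.

eq le : ℕ → ℕ → ℚ
eq zero    zero    = 1ℚ
eq zero    (suc j) = 0ℚ
eq (suc k) zero    = 0ℚ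
eq (suc k) (suc j) = eq k j

le k       zero    = 1ℚ
le zero    (suc j) = 0ℚ
le (suc k) (suc j) = le k j

eq-refl : ∀ k → eq k k ≡ 1ℚ
eq-refl zero    = refl
eq-refl (suc k) = eq-refl k

eq-≢ : ∀ k j → j ≢ k → eq k j ≡ 0ℚ
eq-≢ zero    zero    j≢k = contradiction refl j≢k
eq-≢ zero    (suc j) j≢k = refl
eq-≢ (suc k) zero    j≢k = refl
eq-≢ (suc k) (suc j) j≢k = eq-≢ k j (j≢k ∘ cong suc)

0≤eq : ∀ k j → 0ℚ ≤ eq k j
0≤eq zero    zero    = 0≤ι 1
0≤eq zero    (suc j) = ℚ.≤-refl
0≤eq (suc k) zero    = ℚ.≤-refl
0≤eq (suc k) (suc j) = 0≤eq k j

0≤le : ∀ k j → 0ℚ ≤ le k j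
0≤le k       zero    = 0≤ι 1
0≤le zero    (suc j) = ℚ.≤-refl
0≤le (suc k) (suc j) = 0≤le k j

le≤1 : ∀ k j → le k j ≤ 1ℚ
le≤1 k       zero    = ℚ.≤-refl
le≤1 zero    (suc j) = 0≤ι 1
le≤1 (suc k) (suc j) = le≤1 k j

le-anti : ∀ k {i j} → i ℕ.≤ j → le k j ≤ le k i
le-anti k       {zero}  {j}     _         = le≤1 k j
le-anti zero    {suc i} {suc j} _         = ℚ.≤-refl
le-anti (suc k) {suc i} {suc j} (s≤s i≤j) = le-anti k i≤j

le-shift : ∀ c k j → le (c ℕ.+ k) (c ℕ.+ j) ≡ le k j
le-shift zero    k j = refl
le-shift (suc c) k j = le-shift c k j

-- The increments of `le k` are minus `eq k`; this turns an identity for the increments of `le k`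
-- into one for visits to the level `k`.
le-step : ∀ k j → le k j ≡ eq k j + le k (suc j)
le-step zero    zero    = refl
le-step zero    (suc j) = refl
le-step (suc k) zero    = refl
le-step (suc k) (suc j) = le-step k j

-- The positive part of k + 1 - j, through truncated subtraction: one summation above `le k`.
hinge : ℕ → ℕ → ℚ
hinge k j = ι (suc k ℕ.∸ j)

hinge-step : ∀ k j → hinge k j ≡ le k j + hinge k (suc j)
hinge-step k       zero    = ι-+ 1 k
hinge-step zero    (suc j) = cong ι (ℕ.0∸n≡0 j)
hinge-step (suc k) (suc j) = hinge-step k j

-- Means over uniformly distributed strings.

module Mean (b : ℕ) .{{b>1 : NonTrivial b}} where

  instance
    b≢0 : ℕ.NonZero b
    b≢0 = nonTrivial⇒nonZero b

  β : ℚ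
  β = + 1 / b

  β*b : β * ι b ≡ 1ℚ
  β*b = /-*-cancel 1 b

  β-nonNeg : NonNegative β
  β-nonNeg = ℚ.normalize-nonNeg 1 b

  avg : (Fin b → ℚ) → ℚ
  avg f = β * sumOver (allFin b) f

  avg-cong : ∀ {f g} → (∀ a → f a ≡ g a) → avg f ≡ avg g
  avg-cong f≗g = cong (β *_) (sumOver-cong (allFin b) f≗g)

  avg-mono : ∀ {f g} → (∀ a → f a ≤ g a) → avg f ≤ avg g
  avg-mono f≤g = ℚ.*-monoˡ-≤-nonNeg β {{β-nonNeg}} (sumOver-mono (allFin b) f≤g)

  avg-+ : ∀ f g → avg (λ a → f a + g a) ≡ avg f + avg g
  avg-+ f g = trans (cong (β *_) (sumOver-+ (allFin b) f g)) (ℚ.*-distribˡ-+ β _ _)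

  avg-* : ∀ c f → avg (λ a → c * f a) ≡ c * avg f
  avg-* c f = trans (cong (β *_) (sumOver-* c (allFin b) f)) (e β c (sumOver (allFin b) f))
    where
    e : ∀ x y z → x * (y * z) ≡ y * (x * z)
    e = solve-∀ ℚ-ring

  avg-const : ∀ c → avg (λ _ → c) ≡ c
  avg-const c = begin
    β * sumOver (allFin b) (λ _ → c)   ≡⟨ cong (β *_) (sumOver-const (allFin b) c) ⟩
    β * (ι (length (allFin b)) * c)    ≡⟨ cong (λ n → β * (ι n * c)) (List.length-tabulate {n = b} (λ i → i)) ⟩
    β * (ι b * c)                      ≡⟨ ℚ.*-assoc β (ι b) c ⟨
    β * ι b * c                        ≡⟨ cong (_* c) β*b ⟩
    1ℚ * c                             ≡⟨ ℚ.*-identityˡ c ⟩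
    c                                  ∎
    where open ≡-Reasoning

  -- E n f is the mean of f over the strings of length n, and G L f = Σ_{n < L} E n f.

  E G : ℕ → (Str b → ℚ) → ℚ
  E zero    f = f []
  E (suc n) f = avg (λ a → E n (λ Z → f (a ∷ Z)))

  G zero    f = 0ℚ
  G (suc L) f = f [] + avg (λ a → G L (λ Z → f (a ∷ Z)))

  E-mono-local : ∀ n {f g} → (∀ Z → length Z ≡ n → f Z ≤ g Z) → E n f ≤ E n g
  E-mono-local zero    f≤g = f≤g [] refl
  E-mono-local (suc n) f≤g = avg-mono λ a → E-mono-local n λ Z |Z|≡n → f≤g (a ∷ Z) (cong suc |Z|≡n)

  E-mono : ∀ n {f g} → (∀ Z → f Z ≤ g Z) → E n f ≤ E n g
  E-mono n f≤g = E-mono-local n λ Z _ → f≤g Z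

  E-cong-local : ∀ n {f g} → (∀ Z → length Z ≡ n → f Z ≡ g Z) → E n f ≡ E n g
  E-cong-local zero    f≗g = f≗g [] refl
  E-cong-local (suc n) f≗g = avg-cong λ a → E-cong-local n λ Z |Z|≡n → f≗g (a ∷ Z) (cong suc |Z|≡n)

  E-cong : ∀ n {f g} → (∀ Z → f Z ≡ g Z) → E n f ≡ E n g
  E-cong n f≗g = E-cong-local n λ Z _ → f≗g Z

  E-+ : ∀ n f g → E n (λ Z → f Z + g Z) ≡ E n f + E n g
  E-+ zero    f g = refl
  E-+ (suc n) f g = trans (avg-cong λ a → E-+ n _ _) (avg-+ _ _)

  E-const : ∀ n c → E n (λ _ → c) ≡ c
  E-const zero    c = refl
  E-const (suc n) c = trans (avg-cong λ a → E-const n c) (avg-const c)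

  -- A uniform string may be built from either end. In `renewal` this is the invariance of the
  -- uniform distribution of the state.
  E-snoc : ∀ n f → E (suc n) f ≡ E n (λ Z → avg (λ a → f (Z ++ a ∷ [])))
  E-snoc zero    f = refl
  E-snoc (suc n) f = avg-cong λ a → E-snoc n (λ Z → f (a ∷ Z))

  E-++ : ∀ m n f → E (m ℕ.+ n) f ≡ E m (λ Y → E n (λ Z → f (Y ++ Z)))
  E-++ zero    n f = refl
  E-++ (suc m) n f = avg-cong λ a → E-++ m n (λ Z → f (a ∷ Z))

  G-cong : ∀ L {f g} → (∀ Z → f Z ≡ g Z) → G L f ≡ G L g
  G-cong zero    f≗g = refl
  G-cong (suc L) f≗g = cong₂ _+_ (f≗g []) (avg-cong λ a → G-cong L λ Z → f≗g (a ∷ Z))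

  G-+ : ∀ L f g → G L (λ Z → f Z + g Z) ≡ G L f + G L g
  G-+ zero    f g = refl
  G-+ (suc L) f g = begin
    (f [] + g []) + avg (λ a → G L (λ Z → f (a ∷ Z) + g (a ∷ Z)))  ≡⟨ cong (_+_ (f [] + g [])) (trans (avg-cong λ a → G-+ L _ _) (avg-+ _ _)) ⟩
    (f [] + g []) + (avg _ + avg _)                                ≡⟨ e (f []) (g []) _ _ ⟩
    (f [] + avg _) + (g [] + avg _)                                ∎
    where
    open ≡-Reasoning
    e : ∀ x y z u → (x + y) + (z + u) ≡ (x + z) + (y + u)
    e = solve-∀ ℚ-ring

  G-suc : ∀ L f → G (suc L) f ≡ G L f + E L f
  G-suc zero    f = trans (cong (_+_ (f [])) (avg-const 0ℚ)) (ℚ.+-comm (f []) 0ℚ)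
  G-suc (suc L) f = begin
    f [] + avg (λ a → G (suc L) (λ Z → f (a ∷ Z)))        ≡⟨ cong (_+_ (f [])) (trans (avg-cong λ a → G-suc L _) (avg-+ _ _)) ⟩
    f [] + (avg _ + avg _)                                ≡⟨ ℚ.+-assoc (f []) _ _ ⟨
    G (suc L) f + E (suc L) f                             ∎
    where open ≡-Reasoning

  -- The means of a function that decreases along extensions decrease with the length.
  G-decreasing : ∀ L f → (∀ Z a → f (Z ++ a ∷ []) ≤ f Z) → ι L * E L f ≤ G L f
  G-decreasing zero    f f↘ = ℚ.≤-reflexive (ℚ.*-zeroˡ (f []))
  G-decreasing (suc L) f f↘ = begin
    ι (suc L) * E (suc L) f          ≤⟨ ℚ.*-monoˡ-≤-nonNeg (ι (suc L)) {{ι-nonNeg (suc L)}} step ⟩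
    ι (suc L) * E L f                ≡⟨ cong (_* E L f) (ι-+ 1 L) ⟩
    (1ℚ + ι L) * E L f               ≡⟨ e (ι L) (E L f) ⟩
    ι L * E L f + E L f              ≤⟨ ℚ.+-monoˡ-≤ (E L f) (G-decreasing L f f↘) ⟩
    G L f + E L f                    ≡⟨ G-suc L f ⟨
    G (suc L) f                      ∎
    where
    open ℚ.≤-Reasoning
    e : ∀ l x → (1ℚ + l) * x ≡ l * x + x
    e = solve-∀ ℚ-ring
    step : E (suc L) f ≤ E L f
    step = begin
      E (suc L) f                                ≡⟨ E-snoc L f ⟩
      E L (λ Z → avg (λ a → f (Z ++ a ∷ [])))    ≤⟨ E-mono L (λ Z → ℚ.≤-trans (avg-mono (f↘ Z)) (ℚ.≤-reflexive (avg-const (f Z)))) ⟩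
      E L f                                      ∎

  point : Str b → ℚ → Str b → ℚ
  point X c Z = if does (≡-dec Fin._≟_ Z X) then c else 0ℚ

  point-≡ : ∀ X c → point X c X ≡ c
  point-≡ X c = cong (if_then c else 0ℚ) (dec-true (≡-dec Fin._≟_ X X) refl)

  point-≢ : ∀ X c Z → Z ≢ X → point X c Z ≡ 0ℚ
  point-≢ X c Z Z≢X = cong (if_then c else 0ℚ) (dec-false (≡-dec Fin._≟_ Z X) Z≢X)

  -- One of the b^|X| equally likely strings contributes. This is the source of the constant b^p.
  E-point : ∀ X c → E (length X) (point X c) * ι (b ℕ.^ length X) ≡ c
  E-point []       c = ℚ.*-identityʳ c
  E-point (x ∷ X) c = begin
    avg (λ a → E n (λ Z → point (x ∷ X) c (a ∷ Z))) * ι (b ℕ.* b ℕ.^ n)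
      ≡⟨ cong₂ _*_ (cong (β *_) (sumOver-allFin-point x _ _ (E-cong n at-x) off-x)) (ι-* b (b ℕ.^ n)) ⟩
    (β * E n (point X c)) * (ι b * ι (b ℕ.^ n))
      ≡⟨ e β (E n (point X c)) (ι b) (ι (b ℕ.^ n)) ⟩
    (β * ι b) * (E n (point X c) * ι (b ℕ.^ n))
      ≡⟨ cong₂ _*_ β*b (E-point X c) ⟩
    1ℚ * c
      ≡⟨ ℚ.*-identityˡ c ⟩
    c ∎
    where
    open ≡-Reasoning
    n = length X
    e : ∀ x y z u → (x * y) * (z * u) ≡ (x * z) * (y * u)
    e = solve-∀ ℚ-ring
    at-x : ∀ Z → point (x ∷ X) c (x ∷ Z) ≡ point X c Z
    at-x Z with x Fin.≟ x | ≡-dec Fin._≟_ Z X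
    ... | yes _  | yes _ = refl
    ... | yes _  | no _  = refl
    ... | no x≢x | _     = contradiction refl x≢x
    off-x : ∀ a → a ≢ x → E n (λ Z → point (x ∷ X) c (a ∷ Z)) ≡ 0ℚ
    off-x a a≢x = trans (E-cong n λ Z → point-≢ (x ∷ X) c (a ∷ Z) (a≢x ∘ List.∷-injectiveˡ)) (E-const n 0ℚ)

  -- Counting occurrences, and the renewal identity.

  module Count (w₀ : Fin b) (w′ : Str b) where

    p′ : ℕ
    p′ = length w′

    w : Str b
    w = w₀ ∷ w′

    hit : Str b → ℕ
    hit X = if does (≡-dec Fin._≟_ (take (suc p′) X) w) then 1 else 0

    -- Occurrences are counted by their starting position, so that prepending a letter adds one test
    -- at the front, in step with the recursion of `E` and `G`.
    κ : Str b → ℕ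
    κ []      = 0
    κ (a ∷ X) = hit (a ∷ X) ℕ.+ κ X

    hit-≡ : ∀ X → take (suc p′) X ≡ w → hit X ≡ 1
    hit-≡ X X≡w = cong (if_then 1 else 0) (dec-true (≡-dec Fin._≟_ (take (suc p′) X) w) X≡w)

    hit-≢ : ∀ X → take (suc p′) X ≢ w → hit X ≡ 0
    hit-≢ X X≢w = cong (if_then 1 else 0) (dec-false (≡-dec Fin._≟_ (take (suc p′) X) w) X≢w)

    hit-w : hit w ≡ 1
    hit-w = hit-≡ w (List.take-all (suc p′) w ℕ.≤-refl)

    hit-short : ∀ X → length X ℕ.≤ p′ → hit X ≡ 0
    hit-short X |X|≤p′ = hit-≢ X λ X≡w → ℕ.<-irrefl (begin-equality
      length X                    ≡⟨ ℕ.m≥n⇒m⊓n≡n (ℕ.m≤n⇒m≤1+n |X|≤p′) ⟨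
      suc p′ ℕ.⊓ length X         ≡⟨ List.length-take (suc p′) X ⟨
      length (take (suc p′) X)    ≡⟨ cong length X≡w ⟩
      suc p′                      ∎) (s≤s |X|≤p′)
      where open ℕ.≤-Reasoning

    take-++ : ∀ n (X Z : Str b) → n ℕ.≤ length X → take n (X ++ Z) ≡ take n X
    take-++ zero    X       Z _         = refl
    take-++ (suc n) (a ∷ X) Z (s≤s n≤) = cong (a ∷_) (take-++ n X Z n≤)

    hit-++ : ∀ X Z → suc p′ ℕ.≤ length X → hit (X ++ Z) ≡ hit X
    hit-++ X Z p≤|X| = cong (λ Y → if does (≡-dec Fin._≟_ Y w) then 1 else 0) (take-++ (suc p′) X Z p≤|X|)

    hit≤1 : ∀ X → hit X ℕ.≤ 1
    hit≤1 X with does (≡-dec Fin._≟_ (take (suc p′) X) w)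
    ... | true  = ℕ.≤-refl
    ... | false = z≤n

    κ-short : ∀ X → length X ℕ.≤ p′ → κ X ≡ 0
    κ-short []      _  = refl
    κ-short (a ∷ X) |X|<p′ = cong₂ ℕ._+_ (hit-short (a ∷ X) |X|<p′) (κ-short X (ℕ.<⇒≤ |X|<p′))

    κ≤length : ∀ X → κ X ℕ.≤ length X
    κ≤length []      = z≤n
    κ≤length (a ∷ X) = ℕ.+-mono-≤ (hit≤1 (a ∷ X)) (κ≤length X)

    κ-++-≤ : ∀ Y Z → κ (Y ++ Z) ℕ.≤ length Y ℕ.+ κ Z
    κ-++-≤ []      Z = ℕ.≤-refl
    κ-++-≤ (a ∷ Y) Z = ℕ.+-mono-≤ (hit≤1 (a ∷ Y ++ Z)) (κ-++-≤ Y Z)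

    κ-++-≥ʳ : ∀ Y Z → κ Z ℕ.≤ κ (Y ++ Z)
    κ-++-≥ʳ []      Z = ℕ.≤-refl
    κ-++-≥ʳ (a ∷ Y) Z = ℕ.≤-trans (κ-++-≥ʳ Y Z) (ℕ.m≤n+m _ (hit (a ∷ Y ++ Z)))

    κ-++-≥ˡ : ∀ Y Z → κ Y ℕ.≤ κ (Y ++ Z)
    κ-++-≥ˡ []      Z = z≤n
    κ-++-≥ˡ (a ∷ Y) Z = ℕ.+-mono-≤ hit≤ (κ-++-≥ˡ Y Z)
      where
      hit≤ : hit (a ∷ Y) ℕ.≤ hit (a ∷ Y ++ Z)
      hit≤ with ℕ.≤-<-connex (length (a ∷ Y)) p′
      ... | inj₁ |Y|≤p′ = ℕ.≤-trans (ℕ.≤-reflexive (hit-short (a ∷ Y) |Y|≤p′)) z≤n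
      ... | inj₂ p′<|Y| = ℕ.≤-reflexive (sym (hit-++ (a ∷ Y) Z p′<|Y|))

    -- The mean over the strings u of length p′ of Σ_{n ≤ L} E n (g ∘ κ ∘ (u ++_)) is
    -- evaluated in two ways: splitting off the last term n = L, and splitting off the
    -- first letter a of the continuation, where deleting the first letter of ua loses
    -- an occurrence exactly when ua = w.
    renewal : ∀ (g : ℕ → ℚ) L →
      (E (p′ ℕ.+ L) (λ Z → g (κ Z)) - g 0) * ι (b ℕ.^ suc p′) ≡
      G L (λ Z → g (suc (κ (w′ ++ Z)))) - G L (λ Z → g (κ (w′ ++ Z)))
    renewal g L = begin
      (E (p′ ℕ.+ L) F - g 0) * ι (b ℕ.^ suc p′)
        ≡⟨ cong (_* ι (b ℕ.^ suc p′)) (cancel (E p′ Γ) (E (p′ ℕ.+ L) F) (g 0) (E (suc p′) (point w c)) (trans (sym by-G-suc) by-unfolding)) ⟩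
      E (suc p′) (point w c) * ι (b ℕ.^ suc p′)
        ≡⟨ E-point w c ⟩
      c ∎
      where
      open ≡-Reasoning
      F Γ : Str b → ℚ
      F Z = g (κ Z)
      Γ v = G L (λ Z → F (v ++ Z))
      c : ℚ
      c = G L (λ Z → g (suc (κ (w′ ++ Z)))) - Γ w′

      cancel : ∀ x y z t → x + y ≡ z + (x + t) → y - z ≡ t
      cancel x y z t eq = begin
        y - z                 ≡⟨ e₁ x y z ⟩
        (x + y) - (x + z)     ≡⟨ cong (_- (x + z)) eq ⟩
        (z + (x + t)) - (x + z) ≡⟨ e₂ x z t ⟩
        t ∎
        where
        e₁ : ∀ x y z → y - z ≡ (x + y) - (x + z)
        e₁ = solve-∀ ℚ-ring
        e₂ : ∀ x z t → (z + (x + t)) - (x + z) ≡ t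
        e₂ = solve-∀ ℚ-ring

      by-G-suc : E p′ (λ u → G (suc L) (λ Z → F (u ++ Z))) ≡ E p′ Γ + E (p′ ℕ.+ L) F
      by-G-suc = begin
        E p′ (λ u → G (suc L) (λ Z → F (u ++ Z)))                ≡⟨ E-cong p′ (λ u → G-suc L (λ Z → F (u ++ Z))) ⟩
        E p′ (λ u → Γ u + E L (λ Z → F (u ++ Z)))                ≡⟨ E-+ p′ Γ _ ⟩
        E p′ Γ + E p′ (λ u → E L (λ Z → F (u ++ Z)))             ≡⟨ cong (_+_ (E p′ Γ)) (E-++ p′ L F) ⟨
        E p′ Γ + E (p′ ℕ.+ L) F                                  ∎

      split : ∀ a u → length u ≡ p′ → Γ (a ∷ u) ≡ Γ u + point w c (a ∷ u)
      split a u |u|≡p′ = split-by (≡-dec Fin._≟_ (a ∷ u) w)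
       where
       split-by : Dec (a ∷ u ≡ w) → Γ (a ∷ u) ≡ Γ u + point w c (a ∷ u)
       split-by (yes refl) = begin
        G L (λ Z → g (hit (w ++ Z) ℕ.+ κ (w′ ++ Z)))     ≡⟨ G-cong L (λ Z → cong (λ h → g (h ℕ.+ κ (w′ ++ Z))) (trans (hit-++ w Z ℕ.≤-refl) hit-w)) ⟩
        G L (λ Z → g (suc (κ (w′ ++ Z))))                ≡⟨ e _ (Γ w′) ⟩
        Γ w′ + c                                         ≡⟨ cong (_+_ (Γ w′)) (point-≡ w c) ⟨
        Γ w′ + point w c w                               ∎
        where
        e : ∀ x y → x ≡ y + (x - y)
        e = solve-∀ ℚ-ring
       split-by (no au≢w) = begin
        G L (λ Z → g (hit (a ∷ u ++ Z) ℕ.+ κ (u ++ Z)))  ≡⟨ G-cong L (λ Z → cong (λ h → g (h ℕ.+ κ (u ++ Z))) (no-hit Z)) ⟩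
        Γ u                                              ≡⟨ ℚ.+-identityʳ (Γ u) ⟨
        Γ u + 0ℚ                                         ≡⟨ cong (_+_ (Γ u)) (point-≢ w c (a ∷ u) au≢w) ⟨
        Γ u + point w c (a ∷ u)                          ∎
        where
        no-hit : ∀ Z → hit (a ∷ u ++ Z) ≡ 0
        no-hit Z = trans (hit-++ (a ∷ u) Z (ℕ.≤-reflexive (cong suc (sym |u|≡p′))))
          (hit-≢ (a ∷ u) (au≢w ∘ trans (sym (List.take-all (suc p′) (a ∷ u) (ℕ.≤-reflexive (cong suc |u|≡p′))))))

      by-unfolding : E p′ (λ u → G (suc L) (λ Z → F (u ++ Z))) ≡ g 0 + (E p′ Γ + E (suc p′) (point w c))
      by-unfolding = begin
        E p′ (λ u → F (u ++ []) + avg (λ a → G L (λ Z → F (u ++ a ∷ Z))))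
          ≡⟨ E-+ p′ _ _ ⟩
        E p′ (λ u → F (u ++ [])) + E p′ (λ u → avg (λ a → G L (λ Z → F (u ++ a ∷ Z))))
          ≡⟨ cong₂ _+_ (trans (E-cong-local p′ λ u |u|≡p′ → cong g (trans (cong κ (List.++-identityʳ u)) (κ-short u (ℕ.≤-reflexive |u|≡p′)))) (E-const p′ (g 0)))
                       (E-cong p′ λ u → avg-cong λ a → G-cong L λ Z → cong F (sym (List.++-assoc u (a ∷ []) Z))) ⟩
        g 0 + E p′ (λ u → avg (λ a → Γ (u ++ a ∷ [])))
          -- A uniform state followed by a uniform letter is a uniform string of p letters, which
          -- may be reread as a first letter followed by a state.
          ≡⟨ cong (_+_ (g 0)) (E-snoc p′ Γ) ⟨
        g 0 + avg (λ a → E p′ (λ u → Γ (a ∷ u)))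
          ≡⟨ cong (_+_ (g 0)) (avg-cong λ a → trans (E-cong-local p′ (split a)) (E-+ p′ Γ _)) ⟩
        g 0 + avg (λ a → E p′ Γ + E p′ (λ u → point w c (a ∷ u)))
          ≡⟨ cong (_+_ (g 0)) (trans (avg-+ _ _) (cong (_+ E (suc p′) (point w c)) (avg-const (E p′ Γ)))) ⟩
        g 0 + (E p′ Γ + E (suc p′) (point w c)) ∎

    -- Expected number of visits to a level, after an arbitrary prefix.

    B : ℚ
    B = ι (b ℕ.^ suc p′)

    cyl : Str b → Str b → ℕ
    cyl Y Z = κ (Y ++ Z)

    -- The prefix `w′` is the state left by an occurrence of `w` that has just been completed and is
    -- no longer counted. With `g = le k` the right side of `renewal` is minus the wanted sum, and
    -- `g 0` is 1.
    eqs-after-w′ : ∀ k L → G L (λ Z → eq k (cyl w′ Z)) ≡ B - B * E (p′ ℕ.+ L) (λ Z → le k (κ Z))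
    eqs-after-w′ k L = solve-for _ _ _ _
      (trans (G-cong L λ Z → le-step k (cyl w′ Z)) (G-+ L _ _))
      (renewal (le k) L)
      where
      solve-for : ∀ x y z e → z ≡ x + y → (e - 1ℚ) * B ≡ y - z → x ≡ B - B * e
      solve-for x y z e z≡x+y eq = begin
        x                      ≡⟨ e₁ x y ⟩
        - (y - (x + y))        ≡⟨ cong (λ t → - (y - t)) z≡x+y ⟨
        - (y - z)              ≡⟨ cong -_ eq ⟨
        - ((e - 1ℚ) * B)       ≡⟨ e₂ e B ⟩
        B - B * e              ∎
        where
        open ≡-Reasoning
        e₁ : ∀ x y → x ≡ - (y - (x + y))
        e₁ = solve-∀ ℚ-ring
        e₂ : ∀ e B → - ((e - 1ℚ) * B) ≡ B - B * e
        e₂ = solve-∀ ℚ-ring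

    B-nonNeg : NonNegative B
    B-nonNeg = ι-nonNeg (b ℕ.^ suc p′)

    -- `renewal` with `g = hinge k`: here `g 0` is k + 1, and the mean of `hinge k` is dropped
    -- because it is nonnegative.
    les-after-w′ : ∀ k L → G L (λ Z → le k (cyl w′ Z)) ≤ B * ι (suc k)
    les-after-w′ k L = begin
      G L (λ Z → le k (cyl w′ Z))     ≡⟨ solve-for _ _ _ e (ι (suc k)) (trans (G-cong L λ Z → hinge-step k (cyl w′ Z)) (G-+ L _ _)) (renewal (hinge k) L) ⟩
      B * ι (suc k) - B * e           ≤⟨ ≤-by (e₃ B (ι (suc k)) e) 0≤Be ⟩
      B * ι (suc k)                   ∎
      where
      open ℚ.≤-Reasoning
      e : ℚ
      e = E (p′ ℕ.+ L) (λ Z → hinge k (κ Z))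
      0≤Be : B * 0ℚ ≤ B * e
      0≤Be = ℚ.*-monoˡ-≤-nonNeg B {{B-nonNeg}}
        (subst (_≤ e) (E-const (p′ ℕ.+ L) 0ℚ) (E-mono (p′ ℕ.+ L) λ Z → 0≤ι (suc k ℕ.∸ κ Z)))
      e₁ : ∀ x y → x ≡ - (y - (x + y))
      e₁ = solve-∀ ℚ-ring
      e₂ : ∀ e s B → - ((e - s) * B) ≡ B * s - B * e
      e₂ = solve-∀ ℚ-ring
      e₃ : ∀ B s e → B * e - B * 0ℚ ≡ B * s - (B * s - B * e)
      e₃ = solve-∀ ℚ-ring
      solve-for : ∀ x y z e s → z ≡ x + y → (e - s) * B ≡ y - z → x ≡ B * s - B * e
      solve-for x y z e s z≡x+y eq =
        trans (e₁ x y) (trans (cong (λ t → - (y - t)) (sym z≡x+y)) (trans (cong -_ (sym eq)) (e₂ e s B)))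

    -- Deleting `Y` cannot raise the count, and prepending `w′` raises it by at most its length.
    le-cyl-w′ : ∀ k Y Z → le k (cyl Y Z) ≤ le (k ℕ.+ p′) (cyl w′ Z)
    le-cyl-w′ k Y Z = begin
      le k (κ (Y ++ Z))            ≤⟨ le-anti k (κ-++-≥ʳ Y Z) ⟩
      le k (κ Z)                   ≡⟨ le-shift p′ k (κ Z) ⟨
      le (p′ ℕ.+ k) (p′ ℕ.+ κ Z)   ≤⟨ le-anti (p′ ℕ.+ k) (κ-++-≤ w′ Z) ⟩
      le (p′ ℕ.+ k) (κ (w′ ++ Z))  ≡⟨ cong (λ n → le n (κ (w′ ++ Z))) (ℕ.+-comm p′ k) ⟩
      le (k ℕ.+ p′) (κ (w′ ++ Z))  ∎
      where open ℚ.≤-Reasoning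

    -- The invariant carried from the state `w′` to other prefixes. Its error term involves the same
    -- `f` and `L` as the sum, so it survives averaging over the next letter. The slack `p′` comes
    -- from exchanging a uniform initial state for `w′`.
    Sandwich : ℕ → ℕ → (Str b → ℕ) → Set
    Sandwich L k f =
        G L (λ Z → eq k (f Z)) ≤ B
      × B ≤ G L (λ Z → eq k (f Z)) + B * E L (λ Z → le (k ℕ.+ p′) (f Z))

    sandwich-cong : ∀ {L k f g} → (∀ Z → f Z ≡ g Z) → Sandwich L k f → Sandwich L k g
    sandwich-cong {L} {k} f≗g (upper , lower) =
        ℚ.≤-trans (ℚ.≤-reflexive (G-cong L λ Z → cong (eq k) (sym (f≗g Z)))) upper
      , ℚ.≤-trans lower (ℚ.≤-reflexive (cong₂ (λ x y → x + B * y)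
          (G-cong L λ Z → cong (eq k) (f≗g Z)) (E-cong L λ Z → cong (le (k ℕ.+ p′)) (f≗g Z))))

    sandwich-after-w′ : ∀ k L → Sandwich L k (cyl w′)
    sandwich-after-w′ k L =
        (begin
          G L (λ Z → eq k (cyl w′ Z))    ≡⟨ eqs-after-w′ k L ⟩
          B - B * e                      ≤⟨ ≤-by (e₁ B e) (*B 0≤e) ⟩
          B                              ∎)
      , (begin
          B                              ≡⟨ e₂ B e ⟩
          (B - B * e) + B * e            ≡⟨ cong (_+ B * e) (eqs-after-w′ k L) ⟨
          G L (λ Z → eq k (cyl w′ Z)) + B * e
            ≤⟨ ℚ.+-monoʳ-≤ (G L (λ Z → eq k (cyl w′ Z))) (*B e≤) ⟩
          G L (λ Z → eq k (cyl w′ Z)) + B * E L (λ Z → le (k ℕ.+ p′) (cyl w′ Z)) ∎)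
      where
      open ℚ.≤-Reasoning
      e : ℚ
      e = E (p′ ℕ.+ L) (λ Z → le k (κ Z))
      *B : ∀ {x y} → x ≤ y → B * x ≤ B * y
      *B = ℚ.*-monoˡ-≤-nonNeg B {{B-nonNeg}}
      0≤e : 0ℚ ≤ e
      0≤e = subst (_≤ e) (E-const (p′ ℕ.+ L) 0ℚ) (E-mono (p′ ℕ.+ L) λ Z → 0≤le k (κ Z))
      e≤ : e ≤ E L (λ Z → le (k ℕ.+ p′) (cyl w′ Z))
      e≤ = begin
        E (p′ ℕ.+ L) (λ Z → le k (κ Z))                  ≡⟨ E-++ p′ L _ ⟩
        E p′ (λ u → E L (λ Z → le k (cyl u Z)))          ≤⟨ E-mono p′ (λ u → E-mono L (le-cyl-w′ k u)) ⟩
        E p′ (λ _ → E L (λ Z → le (k ℕ.+ p′) (cyl w′ Z))) ≡⟨ E-const p′ _ ⟩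
        E L (λ Z → le (k ℕ.+ p′) (cyl w′ Z))             ∎
      e₁ : ∀ B e → B * e - B * 0ℚ ≡ B - (B - B * e)
      e₁ = solve-∀ ℚ-ring
      e₂ : ∀ B e → B ≡ (B - B * e) + B * e
      e₂ = solve-∀ ℚ-ring

    -- Since `f []` differs from `k`, the empty continuation contributes nothing, and both bounds
    -- are averages of those after one more letter.
    sandwich-avg : ∀ {L k f} → f [] ≢ k → (∀ a → Sandwich L k (λ Z → f (a ∷ Z))) → Sandwich (suc L) k f
    sandwich-avg {L} {k} {f} f[]≢k S =
        (begin
          eq k (f []) + avg g                     ≡⟨ cong (_+ avg g) (eq-≢ k (f []) f[]≢k) ⟩
          0ℚ + avg g                              ≡⟨ ℚ.+-identityˡ (avg g) ⟩
          avg g                                   ≤⟨ avg-mono (λ a → proj₁ (S a)) ⟩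
          avg (λ _ → B)                           ≡⟨ avg-const B ⟩
          B                                       ∎)
      , (begin
          B                                       ≡⟨ avg-const B ⟨
          avg (λ _ → B)                           ≤⟨ avg-mono (λ a → proj₂ (S a)) ⟩
          avg (λ a → g a + B * h a)               ≡⟨ avg-+ g _ ⟩
          avg g + avg (λ a → B * h a)             ≡⟨ cong (_+_ (avg g)) (avg-* B h) ⟩
          avg g + B * avg h                       ≡⟨ cong (_+ B * avg h) (ℚ.+-identityˡ (avg g)) ⟨
          (0ℚ + avg g) + B * avg h                ≡⟨ cong (λ x → (x + avg g) + B * avg h) (eq-≢ k (f []) f[]≢k) ⟨
          (eq k (f []) + avg g) + B * avg h       ∎)
      where
      open ℚ.≤-Reasoning
      g h : Fin b → ℚ
      g a = G L (λ Z → eq k (f (a ∷ Z)))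
      h a = E L (λ Z → le (k ℕ.+ p′) (f (a ∷ Z)))

    -- The count in Y ++ Z depends on Y only through κ Y and the last p′ letters of Y:
    -- the first letter of a prefix longer than p′ can be dropped.
    sandwich-∷ : ∀ L a Y k → p′ ℕ.≤ length Y →
                 (hit (a ∷ Y) ≡ 0 → Sandwich L (suc k) (cyl Y)) →
                 (take (suc p′) (a ∷ Y) ≡ w → Sandwich L k (cyl Y)) →
                 Sandwich L (suc k) (cyl (a ∷ Y))
    sandwich-∷ L a Y k p′≤|Y| if-no if-yes with ≡-dec Fin._≟_ (take (suc p′) (a ∷ Y)) w
    -- Raising the level and the count together by one leaves `Sandwich` definitionally unchanged.
    ... | yes aY≡w = sandwich-cong {L} {suc k} {λ Z → suc (cyl Y Z)} {cyl (a ∷ Y)}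
      (λ Z → cong (ℕ._+ cyl Y Z) (sym (trans (hit-++ (a ∷ Y) Z (s≤s p′≤|Y|)) (hit-≡ (a ∷ Y) aY≡w))))
      (if-yes aY≡w)
    ... | no aY≢w = sandwich-cong {L} {suc k} {cyl Y} {cyl (a ∷ Y)}
      (λ Z → cong (ℕ._+ cyl Y Z) (sym (trans (hit-++ (a ∷ Y) Z (s≤s p′≤|Y|)) (hit-≢ (a ∷ Y) aY≢w))))
      (if-no (hit-≢ (a ∷ Y) aY≢w))

    -- As `κ Y ≤ k`, the level `suc k` is still ahead and cannot be visited before another
    -- occurrence is completed. Letters are dropped from the front until only the state remains,
    -- each lost occurrence lowering the level by one.
    sandwich : ∀ L Y k → p′ ℕ.≤ length Y → κ Y ℕ.≤ k → Sandwich L (suc k) (cyl Y)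
    -- Waiting for the next occurrence: a letter is appended and the first one dropped. Either `w`
    -- has just been completed, so that the state is `w′`, or the wait goes on with a shorter
    -- continuation.
    sandwich-p′ : ∀ L Y k → length Y ≡ p′ → Sandwich L (suc k) (cyl Y)

    sandwich L Y k p′≤|Y| κY≤k with ℕ.m≤n⇒m<n∨m≡n p′≤|Y|
    sandwich L Y k p′≤|Y| κY≤k | inj₂ p′≡|Y| = sandwich-p′ L Y k (sym p′≡|Y|)
    sandwich L (a ∷ Y) k p′≤|Y| κY≤k | inj₁ (s≤s p′≤|Y|′) =
      sandwich-∷ L a Y k p′≤|Y|′
        (λ _ → sandwich L Y k p′≤|Y|′ (ℕ.≤-trans (ℕ.m≤n+m (κ Y) (hit (a ∷ Y))) κY≤k))
        (λ aY≡w → after-hit k (subst (λ h → h ℕ.+ κ Y ℕ.≤ k) (hit-≡ (a ∷ Y) aY≡w) κY≤k))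
      where
      -- The dropped occurrence is included in the bound by `k`, so `k` is positive and the lowered
      -- level still exceeds `κ Y`.
      after-hit : ∀ k → suc (κ Y) ℕ.≤ k → Sandwich L k (cyl Y)
      after-hit (suc k) (s≤s κY≤k) = sandwich L Y k p′≤|Y|′ κY≤k

    -- With nothing left to read, the error term alone supplies the lower bound: its mean is 1.
    sandwich-p′ zero Y k |Y|≡p′ = ℚ.nonNegative⁻¹ B {{B-nonNeg}} , (begin
      B                                             ≡⟨ e B ⟩
      0ℚ + B * le (suc k ℕ.+ p′) 0                  ≡⟨ cong (λ n → 0ℚ + B * le (suc k ℕ.+ p′) n) κ≡0 ⟨
      0ℚ + B * le (suc k ℕ.+ p′) (cyl Y [])         ∎)
      where
      open ℚ.≤-Reasoning
      e : ∀ B → B ≡ 0ℚ + B * 1ℚ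
      e = solve-∀ ℚ-ring
      κ≡0 : cyl Y [] ≡ 0
      κ≡0 = trans (cong κ (List.++-identityʳ Y)) (κ-short Y (ℕ.≤-reflexive |Y|≡p′))
    sandwich-p′ (suc L) Y k |Y|≡p′ = sandwich-avg {L} {suc k} {cyl Y}
      (λ κY≡sk → ℕ.0≢1+n (trans (sym κ≡0) κY≡sk))
      (λ a → sandwich-cong {L} {suc k} {cyl (Y ++ a ∷ [])} (λ Z → cong κ (List.++-assoc Y (a ∷ []) Z))
        (longer (Y ++ a ∷ []) (trans (List.length-++ Y) (trans (ℕ.+-comm (length Y) 1) (cong suc |Y|≡p′)))))
      where
      κ≡0 : cyl Y [] ≡ 0
      κ≡0 = trans (cong κ (List.++-identityʳ Y)) (κ-short Y (ℕ.≤-reflexive |Y|≡p′))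
      longer : ∀ X → length X ≡ suc p′ → Sandwich L (suc k) (cyl X)
      longer (c ∷ v) |X|≡p = sandwich-∷ L c v k (ℕ.≤-reflexive (sym |v|≡p′))
        (λ _ → sandwich-p′ L v k |v|≡p′)
        (λ cv≡w → subst (λ v → Sandwich L k (cyl v))
          (sym (List.∷-injectiveʳ (trans (sym (List.take-all (suc p′) (c ∷ v) (ℕ.≤-reflexive |X|≡p))) cv≡w)))
          (sandwich-after-w′ k L))
        where
        |v|≡p′ : length v ≡ p′
        |v|≡p′ = ℕ.suc-injective |X|≡p

    -- The probability of few occurrences decreases with the length, so L times its value at L is at
    -- most the sum over smaller lengths, which `les-after-w′` bounds independently of L.
    few-occurrences : ∀ Y k L → ι L * E L (λ Z → le k (cyl Y Z)) ≤ B * ι (suc (k ℕ.+ p′))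
    few-occurrences Y k L = begin
      ι L * E L (λ Z → le k (cyl Y Z))              ≤⟨ ℚ.*-monoˡ-≤-nonNeg (ι L) {{ι-nonNeg L}} (E-mono L (le-cyl-w′ k Y)) ⟩
      ι L * E L (λ Z → le (k ℕ.+ p′) (cyl w′ Z))    ≤⟨ G-decreasing L _ decreasing ⟩
      G L (λ Z → le (k ℕ.+ p′) (cyl w′ Z))          ≤⟨ les-after-w′ (k ℕ.+ p′) L ⟩
      B * ι (suc (k ℕ.+ p′))                        ∎
      where
      open ℚ.≤-Reasoning
      decreasing : ∀ Z a → le (k ℕ.+ p′) (cyl w′ (Z ++ a ∷ [])) ≤ le (k ℕ.+ p′) (cyl w′ Z)
      decreasing Z a = le-anti (k ℕ.+ p′)
        (subst (λ X → κ (w′ ++ Z) ℕ.≤ κ X) (List.++-assoc w′ Z (a ∷ [])) (κ-++-≥ˡ (w′ ++ Z) (a ∷ [])))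

-- Sums over sublists, products, concatenations and level sets.

sumOver-⊆ : ∀ {A : Set} (as bs : List A) (f : A → ℚ) → (∀ a → 0ℚ ≤ f a) →
            Unique as → (∀ {a} → a ∈ₗ as → a ∈ₗ bs) → sumOver as f ≤ sumOver bs f
sumOver-⊆ []       bs f 0≤f _            _   = sumOver-nonNeg bs
  where
  sumOver-nonNeg : ∀ bs → 0ℚ ≤ sumOver bs f
  sumOver-nonNeg []       = ℚ.≤-refl
  sumOver-nonNeg (b ∷ bs) = ℚ.+-mono-≤ (0≤f b) (sumOver-nonNeg bs)
sumOver-⊆ (a ∷ as) bs f 0≤f (a∉as ∷ uas) as⊆bs with Mem.∈-∃++ (as⊆bs (here refl))
... | xs , ys , refl = begin
  f a + sumOver as f                        ≤⟨ ℚ.+-monoʳ-≤ (f a) (sumOver-⊆ as (xs ++ ys) f 0≤f uas without-a) ⟩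
  f a + sumOver (xs ++ ys) f                ≡⟨ cong (_+_ (f a)) (sumOver-++ xs ys f) ⟩
  f a + (sumOver xs f + sumOver ys f)       ≡⟨ e (f a) (sumOver xs f) (sumOver ys f) ⟩
  sumOver xs f + (f a + sumOver ys f)       ≡⟨ sumOver-++ xs (a ∷ ys) f ⟨
  sumOver (xs ++ a ∷ ys) f                  ∎
  where
  open ℚ.≤-Reasoning
  e : ∀ x y z → x + (y + z) ≡ y + (x + z)
  e = solve-∀ ℚ-ring
  without-a : ∀ {c} → c ∈ₗ as → c ∈ₗ xs ++ ys
  without-a c∈as with Mem.∈-++⁻ xs (as⊆bs (there c∈as))
  ... | inj₁ c∈xs         = Mem.∈-++⁺ˡ c∈xs
  ... | inj₂ (here refl)  = contradiction refl (All.lookup a∉as c∈as)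
  ... | inj₂ (there c∈ys) = Mem.∈-++⁺ʳ xs c∈ys

sumOver-cartesian : ∀ {A B C : Set} (h : A → B → C) as bs f →
  sumOver (cartesianProductWith h as bs) f ≡ sumOver as (λ a → sumOver bs (λ b → f (h a b)))
sumOver-cartesian h []       bs f = refl
sumOver-cartesian h (a ∷ as) bs f = trans (sumOver-++ (map (h a) bs) _ f)
  (cong₂ _+_ (sumOver-map (h a) bs f) (sumOver-cartesian h as bs f))

sumOver-concat-≤ : ∀ {A : Set} (f : A → ℚ) c F C → (∀ t → sumOver (F t) f ≤ c) →
                   sumOver (concat (applyUpTo F C)) f ≤ ι C * c
sumOver-concat-≤ f c F zero    F≤ = ℚ.≤-reflexive (sym (ℚ.*-zeroˡ c))
sumOver-concat-≤ f c F (suc C) F≤ = begin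
  sumOver (F 0 ++ concat (applyUpTo (F ∘ suc) C)) f              ≡⟨ sumOver-++ (F 0) _ f ⟩
  sumOver (F 0) f + sumOver (concat (applyUpTo (F ∘ suc) C)) f   ≤⟨ ℚ.+-mono-≤ (F≤ 0) (sumOver-concat-≤ f c (F ∘ suc) C (F≤ ∘ suc)) ⟩
  c + ι C * c                                                    ≡⟨ e c (ι C) ⟩
  (1ℚ + ι C) * c                                                 ≡⟨ cong (_* c) (ι-+ 1 C) ⟨
  ι (suc C) * c                                                  ∎
  where
  open ℚ.≤-Reasoning
  e : ∀ c n → c + n * c ≡ (1ℚ + n) * c
  e = solve-∀ ℚ-ring

sumOver-concat-≥ : ∀ {A : Set} (f : A → ℚ) c F C → (∀ t → c ≤ sumOver (F t) f) →
                   ι C * c ≤ sumOver (concat (applyUpTo F C)) f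
sumOver-concat-≥ f c F zero    ≤F = ℚ.≤-reflexive (ℚ.*-zeroˡ c)
sumOver-concat-≥ f c F (suc C) ≤F = begin
  ι (suc C) * c                                                  ≡⟨ cong (_* c) (ι-+ 1 C) ⟩
  (1ℚ + ι C) * c                                                 ≡⟨ e c (ι C) ⟩
  c + ι C * c                                                    ≤⟨ ℚ.+-mono-≤ (≤F 0) (sumOver-concat-≥ f c (F ∘ suc) C (≤F ∘ suc)) ⟩
  sumOver (F 0) f + sumOver (concat (applyUpTo (F ∘ suc) C)) f   ≡⟨ sumOver-++ (F 0) _ f ⟨
  sumOver (F 0 ++ concat (applyUpTo (F ∘ suc) C)) f              ∎
  where
  open ℚ.≤-Reasoning
  e : ∀ c n → (1ℚ + n) * c ≡ c + n * c
  e = solve-∀ ℚ-ring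

sumOver-level : ∀ {A : Set} (as : List A) (κ : A → ℕ) k f →
  sumOver (filter (λ a → κ a ℕ.≟ k) as) f ≡ sumOver as (λ a → f a * eq k (κ a))
sumOver-level []       κ k f = refl
sumOver-level (a ∷ as) κ k f with κ a ℕ.≟ k
... | yes κa≡k = trans (cong (λ as → sumOver as f) (List.filter-accept (λ a → κ a ℕ.≟ k) κa≡k))
  (trans (cong (_+_ (f a)) (sumOver-level as κ k f)) (cong (_+ sumOver as (λ a → f a * eq k (κ a))) (sym hit)))
  where
  hit : f a * eq k (κ a) ≡ f a
  hit = trans (cong (λ n → f a * eq k n) κa≡k) (trans (cong (f a *_) (eq-refl k)) (ℚ.*-identityʳ (f a)))
... | no κa≢k = trans (cong (λ as → sumOver as f) (List.filter-reject (λ a → κ a ℕ.≟ k) κa≢k))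
  (trans (sumOver-level as κ k f) (trans (sym (ℚ.+-identityˡ _)) (cong (_+ sumOver as (λ a → f a * eq k (κ a))) (sym miss))))
  where
  miss : f a * eq k (κ a) ≡ 0ℚ
  miss = trans (cong (f a *_) (eq-≢ k (κ a) κa≢k)) (ℚ.*-zeroʳ (f a))

length-filter-∷ : ∀ {A : Set} {P : Pred A 0ℓ} (P? : Decidable P) x xs →
  length (filter P? (x ∷ xs)) ≡ (if does (P? x) then 1 else 0) ℕ.+ length (filter P? xs)
length-filter-∷ P? x xs with does (P? x)
... | true  = refl
... | false = refl

-- Weights, positions and b-adic expansions of strings.

module Strings (b : ℕ) .{{b>1 : NonTrivial b}} where
  open Mean b

  val : Str b → ℕ
  val = n⟨_⟩ b

  loc wt : Str b → ℚ
  loc = x⟨_⟩ b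
  wt  = weight b

  b^-nonZero : ∀ n → ℕ.NonZero (b ℕ.^ n)
  b^-nonZero n = ℕ.m^n≢0 b n

  wt-* : ∀ X → wt X * ι (b ℕ.^ length X) ≡ 1ℚ
  wt-* X = /-*-cancel 1 (b ℕ.^ length X) {{b^-nonZero (length X)}}

  loc≡val*wt : ∀ X → loc X ≡ ι (val X) * wt X
  loc≡val*wt X = begin
    loc X                      ≡⟨ ℚ.*-identityʳ (loc X) ⟨
    loc X * 1ℚ                 ≡⟨ cong (loc X *_) (wt-* X) ⟨
    loc X * (wt X * q)         ≡⟨ e (loc X) (wt X) q ⟩
    (loc X * q) * wt X         ≡⟨ cong (_* wt X) (/-*-cancel (val X) (b ℕ.^ length X) {{b^-nonZero (length X)}}) ⟩
    ι (val X) * wt X           ∎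
    where
    open ≡-Reasoning
    q = ι (b ℕ.^ length X)
    e : ∀ x y z → x * (y * z) ≡ (x * z) * y
    e = solve-∀ ℚ-ring

  wt-unique : ∀ {x n} → x * ι (b ℕ.^ n) ≡ 1ℚ → ∀ X → length X ≡ n → wt X ≡ x
  wt-unique {x} {n} xq≡1 X refl = begin
    wt X                 ≡⟨ ℚ.*-identityˡ (wt X) ⟨
    1ℚ * wt X            ≡⟨ cong (_* wt X) xq≡1 ⟨
    (x * q) * wt X       ≡⟨ e x q (wt X) ⟩
    x * (wt X * q)       ≡⟨ cong (x *_) (wt-* X) ⟩
    x * 1ℚ               ≡⟨ ℚ.*-identityʳ x ⟩
    x                    ∎
    where
    open ≡-Reasoning
    q = ι (b ℕ.^ length X)
    e : ∀ x y z → (x * y) * z ≡ x * (z * y)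
    e = solve-∀ ℚ-ring

  wt-∷ : ∀ a X → wt (a ∷ X) ≡ β * wt X
  wt-∷ a X = wt-unique {β * wt X} {suc n} (begin
    (β * wt X) * ι (b ℕ.* b ℕ.^ n)        ≡⟨ cong ((β * wt X) *_) (ι-* b (b ℕ.^ n)) ⟩
    (β * wt X) * (ι b * ι (b ℕ.^ n))      ≡⟨ e β (wt X) (ι b) (ι (b ℕ.^ n)) ⟩
    (β * ι b) * (wt X * ι (b ℕ.^ n))      ≡⟨ cong₂ _*_ β*b (wt-* X) ⟩
    1ℚ * 1ℚ                               ≡⟨ ℚ.*-identityˡ 1ℚ ⟩
    1ℚ                                    ∎) (a ∷ X) refl
    where
    open ≡-Reasoning
    n = length X
    e : ∀ x y z u → (x * y) * (z * u) ≡ (x * z) * (y * u)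
    e = solve-∀ ℚ-ring

  wt-++ : ∀ Y Z → wt (Y ++ Z) ≡ wt Y * wt Z
  wt-++ []      Z = sym (ℚ.*-identityˡ (wt Z))
  wt-++ (a ∷ Y) Z = begin
    wt (a ∷ Y ++ Z)        ≡⟨ wt-∷ a (Y ++ Z) ⟩
    β * wt (Y ++ Z)        ≡⟨ cong (β *_) (wt-++ Y Z) ⟩
    β * (wt Y * wt Z)      ≡⟨ ℚ.*-assoc β (wt Y) (wt Z) ⟨
    β * wt Y * wt Z        ≡⟨ cong (_* wt Z) (wt-∷ a Y) ⟨
    wt (a ∷ Y) * wt Z      ∎
    where open ≡-Reasoning

  wt-pos : ∀ X → Positive (wt X)
  wt-pos X = ℚ.normalize-pos 1 (b ℕ.^ length X) {{b^-nonZero (length X)}}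

  0≤wt : ∀ X → 0ℚ ≤ wt X
  0≤wt X = ℚ.<⇒≤ (ℚ.positive⁻¹ (wt X) {{wt-pos X}})

  words : ℕ → List (Str b)
  words zero    = []
  words (suc L) = [] ∷ cartesianProductWith _∷_ (allFin b) (words L)

  words-unique : ∀ L → Unique (words L)
  words-unique zero    = []
  words-unique (suc L) = All.tabulate []∉ ∷
    Unique.cartesianProductWith⁺ _∷_ List.∷-injective (Unique.allFin⁺ b) (words-unique L)
    where
    []∉ : ∀ {X} → X ∈ₗ cartesianProductWith _∷_ (allFin b) (words L) → [] ≢ X
    []∉ X∈ refl with Mem.∈-cartesianProductWith⁻ _∷_ (allFin b) (words L) X∈
    ... | _ , _ , _ , _ , ()

  words-complete : ∀ L X → length X ℕ.< L → X ∈ₗ words L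
  words-complete (suc L) []      _            = here refl
  words-complete (suc L) (a ∷ X) (s≤s |X|<L) =
    there (Mem.∈-cartesianProductWith⁺ _∷_ (Mem.∈-allFin a) (words-complete L X |X|<L))

  sumOver-words : ∀ L f → sumOver (words L) (λ Z → wt Z * f Z) ≡ G L f
  sumOver-words zero    f = refl
  sumOver-words (suc L) f = cong₂ _+_ (ℚ.*-identityˡ (f [])) (begin
    sumOver (cartesianProductWith _∷_ (allFin b) (words L)) (λ Z → wt Z * f Z)
      ≡⟨ sumOver-cartesian _∷_ (allFin b) (words L) _ ⟩
    sumOver (allFin b) (λ a → sumOver (words L) (λ Z → wt (a ∷ Z) * f (a ∷ Z)))
      ≡⟨ sumOver-cong (allFin b) (λ a → begin
           sumOver (words L) (λ Z → wt (a ∷ Z) * f (a ∷ Z))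
             ≡⟨ sumOver-cong (words L) (λ Z → trans (cong (_* f (a ∷ Z)) (wt-∷ a Z)) (ℚ.*-assoc β (wt Z) (f (a ∷ Z)))) ⟩
           sumOver (words L) (λ Z → β * (wt Z * f (a ∷ Z)))
             ≡⟨ sumOver-* β (words L) _ ⟩
           β * sumOver (words L) (λ Z → wt Z * f (a ∷ Z))
             ≡⟨ cong (β *_) (sumOver-words L (λ Z → f (a ∷ Z))) ⟩
           β * G L (λ Z → f (a ∷ Z)) ∎) ⟩
    sumOver (allFin b) (λ a → β * G L (λ Z → f (a ∷ Z)))
      ≡⟨ sumOver-* β (allFin b) _ ⟩
    avg (λ a → G L (λ Z → f (a ∷ Z))) ∎)
    where open ≡-Reasoning

  cylinder : Str b → ℕ → List (Str b)
  cylinder Y L = map (Y ++_) (words L)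

  sumOver-cylinder : ∀ Y L (f : Str b → ℚ) → sumOver (cylinder Y L) (λ X → wt X * f X) ≡ wt Y * G L (λ Z → f (Y ++ Z))
  sumOver-cylinder Y L f = begin
    sumOver (map (Y ++_) (words L)) (λ X → wt X * f X)         ≡⟨ sumOver-map (Y ++_) (words L) _ ⟩
    sumOver (words L) (λ Z → wt (Y ++ Z) * f (Y ++ Z))         ≡⟨ sumOver-cong (words L) (λ Z → trans (cong (_* f (Y ++ Z)) (wt-++ Y Z)) (ℚ.*-assoc (wt Y) (wt Z) _)) ⟩
    sumOver (words L) (λ Z → wt Y * (wt Z * f (Y ++ Z)))       ≡⟨ sumOver-* (wt Y) (words L) _ ⟩
    wt Y * sumOver (words L) (λ Z → wt Z * f (Y ++ Z))         ≡⟨ cong (wt Y *_) (sumOver-words L _) ⟩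
    wt Y * G L (λ Z → f (Y ++ Z))                              ∎
    where open ≡-Reasoning

  val-from : ∀ x Z → foldl (λ n d → n ℕ.* b ℕ.+ toℕ d) x Z ≡ x ℕ.* b ℕ.^ length Z ℕ.+ val Z
  val-from x []      = sym (trans (ℕ.+-identityʳ (x ℕ.* 1)) (ℕ.*-identityʳ x))
  val-from x (a ∷ Z) = begin
    foldl (λ n d → n ℕ.* b ℕ.+ toℕ d) (x ℕ.* b ℕ.+ toℕ a) Z   ≡⟨ val-from (x ℕ.* b ℕ.+ toℕ a) Z ⟩
    (x ℕ.* b ℕ.+ toℕ a) ℕ.* q ℕ.+ val Z                       ≡⟨ e x b (toℕ a) q (val Z) ⟩
    x ℕ.* (b ℕ.* q) ℕ.+ (toℕ a ℕ.* q ℕ.+ val Z)               ≡⟨ cong (x ℕ.* (b ℕ.* q) ℕ.+_) (val-from (toℕ a) Z) ⟨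
    x ℕ.* (b ℕ.* q) ℕ.+ val (a ∷ Z)                           ∎
    where
    open ≡-Reasoning
    q = b ℕ.^ length Z
    e : ∀ x b a q v → (x ℕ.* b ℕ.+ a) ℕ.* q ℕ.+ v ≡ x ℕ.* (b ℕ.* q) ℕ.+ (a ℕ.* q ℕ.+ v)
    e = ℕ-Solver.solve-∀

  val-++ : ∀ Y Z → val (Y ++ Z) ≡ val Y ℕ.* b ℕ.^ length Z ℕ.+ val Z
  val-++ Y Z = trans (List.foldl-++ _ 0 Y Z) (val-from (val Y) Z)

  val< : ∀ Z → val Z ℕ.< b ℕ.^ length Z
  val< []      = s≤s z≤n
  val< (a ∷ Z) = begin-strict
    val (a ∷ Z)               ≡⟨ val-from (toℕ a) Z ⟩
    toℕ a ℕ.* q ℕ.+ val Z     <⟨ ℕ.+-monoʳ-< (toℕ a ℕ.* q) (val< Z) ⟩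
    toℕ a ℕ.* q ℕ.+ q         ≡⟨ ℕ.+-comm (toℕ a ℕ.* q) q ⟩
    suc (toℕ a) ℕ.* q         ≤⟨ ℕ.*-monoˡ-≤ q (Fin.toℕ<n a) ⟩
    b ℕ.* q                   ∎
    where
    open ℕ.≤-Reasoning
    q = b ℕ.^ length Z

  loc-++ : ∀ Y Z → loc (Y ++ Z) ≡ (ι (val Y) + loc Z) * wt Y
  loc-++ Y Z = begin
    loc (Y ++ Z)                                        ≡⟨ loc≡val*wt (Y ++ Z) ⟩
    ι (val (Y ++ Z)) * wt (Y ++ Z)                      ≡⟨ cong₂ _*_ (trans (cong ι (val-++ Y Z)) (trans (ι-+ (val Y ℕ.* b ℕ.^ length Z) (val Z)) (cong (_+ ι (val Z)) (ι-* (val Y) (b ℕ.^ length Z))))) (wt-++ Y Z) ⟩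
    (ι (val Y) * q + ι (val Z)) * (wt Y * wt Z)         ≡⟨ e₁ (ι (val Y)) q (ι (val Z)) (wt Y) (wt Z) ⟩
    (ι (val Y) * (wt Z * q) + ι (val Z) * wt Z) * wt Y  ≡⟨ cong₂ (λ x y → (ι (val Y) * x + y) * wt Y) (wt-* Z) (sym (loc≡val*wt Z)) ⟩
    (ι (val Y) * 1ℚ + loc Z) * wt Y                     ≡⟨ cong (λ x → (x + loc Z) * wt Y) (ℚ.*-identityʳ (ι (val Y))) ⟩
    (ι (val Y) + loc Z) * wt Y                          ∎
    where
    open ≡-Reasoning
    q = ι (b ℕ.^ length Z)
    e₁ : ∀ a q c y z → (a * q + c) * (y * z) ≡ (a * (z * q) + c * z) * y
    e₁ = solve-∀ ℚ-ring

  0≤loc : ∀ Z → 0ℚ ≤ loc Z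
  0≤loc Z = ℚ.nonNegative⁻¹ (loc Z) {{ℚ.normalize-nonNeg (val Z) (b ℕ.^ length Z) {{b^-nonZero (length Z)}}}}

  loc≤1 : ∀ Z → loc Z ≤ 1ℚ
  loc≤1 Z = begin
    loc Z                              ≡⟨ loc≡val*wt Z ⟩
    ι (val Z) * wt Z                   ≤⟨ ℚ.*-monoʳ-≤-nonNeg (wt Z) {{ℚ.pos⇒nonNeg (wt Z) {{wt-pos Z}}}} (ι-mono-≤ (ℕ.<⇒≤ (val< Z))) ⟩
    ι (b ℕ.^ length Z) * wt Z          ≡⟨ trans (ℚ.*-comm _ (wt Z)) (wt-* Z) ⟩
    1ℚ                                 ∎
    where open ℚ.≤-Reasoning

  -- For `j` at least b^m this is the expansion of its residue, still of length `m`; `mass-upper`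
  -- may meet such `j`.
  digits : ℕ → ℕ → Str b
  digits zero    j = []
  digits (suc m) j = digits m (j ℕ./ b) ∷ʳ (j mod b)

  length-digits : ∀ m j → length (digits m j) ≡ m
  length-digits zero    j = refl
  length-digits (suc m) j = trans (List.length-++ (digits m (j ℕ./ b)))
    (trans (ℕ.+-comm _ 1) (cong suc (length-digits m (j ℕ./ b))))

  val-digits : ∀ m j → j ℕ.< b ℕ.^ m → val (digits m j) ≡ j
  val-digits zero    zero _      = refl
  val-digits zero    (suc j) (s≤s ())
  val-digits (suc m) j    j<b^m = begin
    val (digits m (j ℕ./ b) ∷ʳ (j mod b))               ≡⟨ List.foldl-∷ʳ _ 0 (j mod b) (digits m (j ℕ./ b)) ⟩
    val (digits m (j ℕ./ b)) ℕ.* b ℕ.+ toℕ (j mod b)    ≡⟨ cong₂ (λ x y → x ℕ.* b ℕ.+ y) (val-digits m (j ℕ./ b) (m<n*o⇒m/o<n (subst (j ℕ.<_) (ℕ.*-comm b (b ℕ.^ m)) j<b^m))) (Fin.toℕ-fromℕ< (m%n<n j b)) ⟩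
    j ℕ./ b ℕ.* b ℕ.+ j ℕ.% b                             ≡⟨ ℕ.+-comm (j ℕ./ b ℕ.* b) (j ℕ.% b) ⟩
    j ℕ.% b ℕ.+ j ℕ./ b ℕ.* b                             ≡⟨ m≡m%n+[m/n]*n j b ⟨
    j                                                 ∎
    where open ≡-Reasoning

  digits-val : ∀ m Y → length Y ≡ m → digits m (val Y) ≡ Y
  digits-val zero    []      _     = refl
  digits-val (suc m) Y       |Y|≡ with initLast Y
  ... | Y′ ∷ʳ′ d = cong₂ _∷ʳ_ (trans (cong (digits m) quotient) (digits-val m Y′ |Y′|≡m)) (Fin.toℕ-injective (begin
    toℕ (val (Y′ ∷ʳ d) mod b)              ≡⟨ Fin.toℕ-fromℕ< (m%n<n (val (Y′ ∷ʳ d)) b) ⟩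
    val (Y′ ∷ʳ d) ℕ.% b                      ≡⟨ cong (ℕ._% b) val-∷ʳ ⟩
    (toℕ d ℕ.+ val Y′ ℕ.* b) ℕ.% b           ≡⟨ [m+kn]%n≡m%n (toℕ d) (val Y′) b ⟩
    toℕ d ℕ.% b                              ≡⟨ m<n⇒m%n≡m (Fin.toℕ<n d) ⟩
    toℕ d                                  ∎))
    where
    open ≡-Reasoning
    |Y′|≡m : length Y′ ≡ m
    |Y′|≡m = ℕ.suc-injective (trans (trans (ℕ.+-comm 1 (length Y′)) (sym (List.length-++ Y′))) |Y|≡)
    val-∷ʳ : val (Y′ ∷ʳ d) ≡ toℕ d ℕ.+ val Y′ ℕ.* b
    val-∷ʳ = trans (List.foldl-∷ʳ _ 0 d Y′) (ℕ.+-comm (val Y′ ℕ.* b) (toℕ d))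
    quotient : val (Y′ ∷ʳ d) ℕ./ b ≡ val Y′
    quotient = begin
      val (Y′ ∷ʳ d) ℕ./ b                      ≡⟨ cong (ℕ._/ b) val-∷ʳ ⟩
      (toℕ d ℕ.+ val Y′ ℕ.* b) ℕ./ b           ≡⟨ +-distrib-/-∣ʳ (toℕ d) {val Y′ ℕ.* b} {b} (divides-refl (val Y′)) ⟩
      toℕ d ℕ./ b ℕ.+ val Y′ ℕ.* b ℕ./ b         ≡⟨ cong₂ ℕ._+_ (m<n⇒m/n≡0 (Fin.toℕ<n d)) (m*n/n≡m (val Y′) b) ⟩
      val Y′                                 ∎

  module _ (w₀ : Fin b) (w′ : Str b) where
    open Count w₀ w′

    occurrences≡κ : ∀ {p} (v : Vec (Fin b) p) → p ≡ suc p′ → toList v ≡ w → ∀ X → occurrences b v X ≡ κ X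
    occurrences≡κ v p≡ v≡w X = general _ _ p≡ v≡w
      where
      -- Positions refer to the whole string `X` while the recursion runs over its suffix `Z`; `f`
      -- translates between the two.
      count : ∀ Z f → (∀ i → drop (f i) X ≡ drop i Z) →
        length (filter (λ i → ≡-dec Fin._≟_ (take (suc p′) (drop i X)) w) (applyUpTo f (length Z))) ≡ κ Z
      count []      f _      = refl
      count (a ∷ Z) f drop-f = trans (length-filter-∷ (λ i → ≡-dec Fin._≟_ (take (suc p′) (drop i X)) w) (f 0) _)
        (cong₂ ℕ._+_ (cong (λ Y → if does (≡-dec Fin._≟_ (take (suc p′) Y) w) then 1 else 0) (drop-f 0))
                     (count Z (f ∘ suc) (λ i → drop-f (suc i))))
      general : ∀ q W → q ≡ suc p′ → W ≡ w →
        length (filter (λ i → ≡-dec Fin._≟_ (take q (drop i X)) W) (upTo (length X))) ≡ κ X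
      general _ _ refl refl = count X (λ i → i) (λ _ → refl)

-- Archimedean estimates, and locating a real on a grid.

archimedean : ∀ ε → 0ℚ < ε → ∃[ D ] 1ℚ ≤ ε * ι D
archimedean ε@(mkℚ (+ zero) d c) 0<ε with () ← positive 0<ε
archimedean ε@(mkℚ (ℤ.-[1+ a ]) d c) 0<ε with () ← positive 0<ε
-- The denominator serves, the numerator being at least 1.
archimedean ε@(mkℚ (+ suc a) d c) 0<ε = suc d , (begin
  1ℚ                               ≤⟨ ι-mono-≤ {1} {suc a} (s≤s z≤n) ⟩
  ι (suc a)                        ≡⟨ /-*-cancel (suc a) (suc d) ⟨
  (+ suc a / suc d) * ι (suc d)    ≡⟨ cong (_* ι (suc d)) (ℚ.↥p/↧p≡p ε) ⟩
  ε * ι (suc d)                    ∎)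
  where open ℚ.≤-Reasoning

m<b^m : ∀ b .{{_ : NonTrivial b}} m → m ℕ.< b ℕ.^ m
m<b^m b zero    = s≤s z≤n
m<b^m b (suc m) = begin-strict
  suc m                              ≤⟨ m<b^m b m ⟩
  b ℕ.^ m                            <⟨ ℕ.m<m+n (b ℕ.^ m) (ℕ.≤-<-trans z≤n (m<b^m b m)) ⟩
  b ℕ.^ m ℕ.+ b ℕ.^ m                ≡⟨ cong (b ℕ.^ m ℕ.+_) (ℕ.+-identityʳ (b ℕ.^ m)) ⟨
  2 ℕ.* b ℕ.^ m                      ≤⟨ ℕ.*-monoˡ-≤ (b ℕ.^ m) (nonTrivial⇒n>1 b) ⟩
  b ℕ.* b ℕ.^ m                      ∎
  where open ℕ.≤-Reasoning

-- The range starts at -1 because rational approximations to an end point may fall slightly below 0.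
near-ι : ∀ n y → - 1ℚ < y → y < ι n → ∃[ u ] (ι u - 1ℚ < y × y < ι u + 1ℚ)
near-ι zero    y -1<y y<n = 0 , -1<y , ℚ.<-trans y<n (ℚ.positive⁻¹ 1ℚ)
near-ι (suc n) y -1<y y<n with y <? 1ℚ
... | yes y<1 = 0 , -1<y , y<1
... | no y≮1  = shift (near-ι n (y - 1ℚ) -1<y-1 (<-by (e₂ y (ι n)) (subst (y <_) (ι-+ 1 n) y<n)))
  where
  e₁ : ∀ y → y - 1ℚ ≡ (y - 1ℚ) - 0ℚ
  e₁ = solve-∀ ℚ-ring
  -1<y-1 : - 1ℚ < y - 1ℚ
  -1<y-1 = ℚ.<-≤-trans (ℚ.negative⁻¹ (- 1ℚ)) (≤-by (e₁ y) (ℚ.≮⇒≥ y≮1))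
  e₂ : ∀ y n → (1ℚ + n) - y ≡ n - (y - 1ℚ)
  e₂ = solve-∀ ℚ-ring
  e₃ : ∀ u y → (y - 1ℚ) - (u - 1ℚ) ≡ y - ((1ℚ + u) - 1ℚ)
  e₃ = solve-∀ ℚ-ring
  e₄ : ∀ u y → (u + 1ℚ) - (y - 1ℚ) ≡ ((1ℚ + u) + 1ℚ) - y
  e₄ = solve-∀ ℚ-ring
  shift : ∃[ u ] (ι u - 1ℚ < y - 1ℚ × y - 1ℚ < ι u + 1ℚ) → ∃[ u ] (ι u - 1ℚ < y × y < ι u + 1ℚ)
  shift (u , lower , upper) = suc u
    , subst (λ x → x - 1ℚ < y) (sym (ι-+ 1 u)) (<-by (e₃ (ι u) y) lower)
    , subst (λ x → y < x + 1ℚ) (sym (ι-+ 1 u)) (<-by (e₄ (ι u) y) upper)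

Eventually : (ℕ → Set) → Set
Eventually P = ∃[ N ] (∀ n → N ℕ.≤ n → P n)

module _ {P Q : ℕ → Set} where

  infixr 4 _&_
  _&_ : Eventually P → Eventually Q → Eventually (λ n → P n × Q n)
  (M , p) & (N , q) = M ℕ.⊔ N , λ n M⊔N≤n → p n (ℕ.m⊔n≤o⇒m≤o M N M⊔N≤n) , q n (ℕ.m⊔n≤o⇒n≤o M N M⊔N≤n)

  eventually-map : (∀ {n} → P n → Q n) → Eventually P → Eventually Q
  eventually-map f (N , p) = N , λ n N≤n → f (p n N≤n)

always : ∀ {P : Set} → Eventually (λ _ → P) → P
always (N , p) = p N ℕ.≤-refl

p≤∣p∣ : ∀ p → p ≤ ∣ p ∣
p≤∣p∣ p with ℚ.≤-total 0ℚ p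
... | inj₁ 0≤p = ℚ.≤-reflexive (sym (ℚ.0≤p⇒∣p∣≡p 0≤p))
... | inj₂ p≤0 = ℚ.≤-trans p≤0 (ℚ.0≤∣p∣ p)

module Grid (r : ℚ) (r>0 : 0ℚ < r) (M : ℕ) (r*M : r * ι M ≡ 1ℚ) where

  instance
    r-pos : Positive r
    r-pos = positive r>0

  r-nonNeg : NonNegative r
  r-nonNeg = ℚ.pos⇒nonNeg r

  h : ℚ
  h = ½ * r

  h>0 : 0ℚ < h
  h>0 = ℚ.positive⁻¹ h {{ℚ.pos*pos⇒pos ½ r}}

  Near : ℝ → ℕ → Set
  Near x u = Eventually (λ n → (ι u - ι 2) * r < seq x n × seq x n < (ι u + ι 2) * r)

  -- One late term of the Cauchy sequence is rounded, since comparisons of rationals are decidable.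
  -- Rounding costs one mesh width and passing to later terms a second, whence the radius 2r in
  -- `Near`.
  near : ∀ x → Eventually (λ n → - r < seq x n × seq x n < 1ℚ + r) → ∃[ u ] Near x u
  near x bounded = from-sample (proj₁ together) (proj₂ together (proj₁ together) ℕ.≤-refl)
    where
    N₁ : ℕ
    N₁ = proj₁ (cauchy x r r>0)
    together : Eventually (λ n → (- r < seq x n × seq x n < 1ℚ + r) × N₁ ℕ.≤ n)
    together = bounded & (N₁ , λ n N₁≤n → N₁≤n)
    scaled : ∀ q → (q * ι M) * r ≡ q
    scaled q = trans (e q (ι M) r) (trans (cong (q *_) r*M) (ℚ.*-identityʳ q))
      where
      e : ∀ q m r → (q * m) * r ≡ q * (r * m)
      e = solve-∀ ℚ-ring
    *-cancel-r : ∀ {p q} → p * r < q * r → p < q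
    *-cancel-r = ℚ.*-cancelʳ-<-nonNeg r {{r-nonNeg}}
    from-sample : ∀ N → (- r < seq x N × seq x N < 1ℚ + r) × N₁ ℕ.≤ N → ∃[ u ] Near x u
    -- Measured in units of `r`, the upper bound 1 + r is M + 1.
    from-sample N ((-r<q , q<1+r) , N₁≤N) = around (near-ι (M ℕ.+ 1) (q * ι M)
      (*-cancel-r (subst₂ _<_ (e₁ r) (sym (scaled q)) -r<q))
      (*-cancel-r (subst₂ _<_ (sym (scaled q)) (trans (cong (_+ r) (sym (scaled 1ℚ))) (trans (e₂ (ι M) r) (cong (_* r) (sym (ι-+ M 1))))) q<1+r)))
      where
      q : ℚ
      q = seq x N
      e₁ : ∀ r → - r ≡ - 1ℚ * r
      e₁ = solve-∀ ℚ-ring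
      e₂ : ∀ m r → (1ℚ * m) * r + r ≡ (m + 1ℚ) * r
      e₂ = solve-∀ ℚ-ring
      e₃ : ∀ u r q x → (q + r) - ((u - 1ℚ) * r + (q - x)) ≡ x - (u - ι 2) * r
      e₃ = solve-∀ ℚ-ring
      e₄ : ∀ u r q x → ((u + 1ℚ) * r + r) - (q + (x - q)) ≡ (u + ι 2) * r - x
      e₄ = solve-∀ ℚ-ring
      around : ∃[ u ] (ι u - 1ℚ < q * ι M × q * ι M < ι u + 1ℚ) → ∃[ u ] Near x u
      around (u , lower , upper) = u , N , λ n N≤n →
          <-by (e₃ (ι u) r q (seq x n)) (ℚ.+-mono-<
            (subst ((ι u - 1ℚ) * r <_) (scaled q) (ℚ.*-monoˡ-<-pos r lower))
            (ℚ.≤-<-trans (p≤∣p∣ (q - seq x n)) (proj₂ (cauchy x r r>0) N n N₁≤N (ℕ.≤-trans N₁≤N N≤n))))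
        , <-by (e₄ (ι u) r q (seq x n)) (ℚ.+-mono-<
            (subst (_< (ι u + 1ℚ) * r) (scaled q) (ℚ.*-monoˡ-<-pos r upper))
            (ℚ.≤-<-trans (p≤∣p∣ (seq x n - q)) (proj₂ (cauchy x r r>0) n N (ℕ.≤-trans N₁≤N N≤n) N₁≤N)))

  <-from-grid : ∀ {m n} c → (ι m) * r < (ι n + ι c) * r → m ℕ.< n ℕ.+ c
  <-from-grid {m} {n} c lt = ι-cancel-< (subst (ι m <_) (sym (ι-+ n c)) (ℚ.*-cancelʳ-<-nonNeg r {{r-nonNeg}} lt))

-- The mass of runs of consecutive b-adic cells.

module Mass (b : ℕ) .{{b>1 : NonTrivial b}} (w₀ : Fin b) (w′ : Str b) (m : ℕ) where
  open Mean b
  open Count w₀ w′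
  open Strings b

  -- Opaque because unfolding r lets the arithmetic of ℚ compute on open terms.
  opaque
    r : ℚ
    r = _/b^_ b 1 m

    r≡ : r ≡ _/b^_ b 1 m
    r≡ = refl

  wt≡r : ∀ Y → length Y ≡ m → wt Y ≡ r
  wt≡r Y refl = sym r≡

  wt-digits : ∀ j → wt (digits m j) ≡ r
  wt-digits j = wt≡r (digits m j) (length-digits m j)

  r*M : r * ι (b ℕ.^ m) ≡ 1ℚ
  r*M = trans (cong (_* ι (b ℕ.^ m)) r≡) (/-*-cancel 1 (b ℕ.^ m) {{b^-nonZero m}})

  0<r : 0ℚ < r
  0<r = subst (0ℚ <_) (wt-digits 0) (ℚ.positive⁻¹ (wt (digits m 0)) {{wt-pos (digits m 0)}})

  r-nonNeg : NonNegative r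
  r-nonNeg = nonNegative (ℚ.<⇒≤ 0<r)

  loc-≥ : ∀ Y Z → length Y ≡ m → ι (val Y) * r ≤ loc (Y ++ Z)
  loc-≥ Y Z |Y|≡m = begin
    ι (val Y) * r                  ≡⟨ cong (_* r) (ℚ.+-identityʳ (ι (val Y))) ⟨
    (ι (val Y) + 0ℚ) * r           ≤⟨ ℚ.*-monoʳ-≤-nonNeg r {{r-nonNeg}} (ℚ.+-monoʳ-≤ (ι (val Y)) (0≤loc Z)) ⟩
    (ι (val Y) + loc Z) * r        ≡⟨ cong ((ι (val Y) + loc Z) *_) (wt≡r Y |Y|≡m) ⟨
    (ι (val Y) + loc Z) * wt Y     ≡⟨ loc-++ Y Z ⟨
    loc (Y ++ Z)                   ∎
    where open ℚ.≤-Reasoning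

  loc-≤ : ∀ Y Z → length Y ≡ m → loc (Y ++ Z) ≤ (ι (val Y) + 1ℚ) * r
  loc-≤ Y Z |Y|≡m = begin
    loc (Y ++ Z)                   ≡⟨ loc-++ Y Z ⟩
    (ι (val Y) + loc Z) * wt Y     ≡⟨ cong ((ι (val Y) + loc Z) *_) (wt≡r Y |Y|≡m) ⟩
    (ι (val Y) + loc Z) * r        ≤⟨ ℚ.*-monoʳ-≤-nonNeg r {{r-nonNeg}} (ℚ.+-monoʳ-≤ (ι (val Y)) (loc≤1 Z)) ⟩
    (ι (val Y) + 1ℚ) * r           ∎
    where open ℚ.≤-Reasoning

  module _ (p′≤m : p′ ℕ.≤ m) (k : ℕ) (m≤k : m ℕ.≤ k) where

    -- There are at least as many letters as occurrences, so for `m ≤ k` every string that counts is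
    -- long enough to lie in a cylinder of depth `m`.
    length-take-m : ∀ {X} → κ X ≡ suc k → length (take m X) ≡ m
    length-take-m {X} κX = trans (List.length-take m X) (ℕ.m≤n⇒m⊓n≡m m≤|X|)
      where
      m≤|X| : m ℕ.≤ length X
      m≤|X| = ℕ.≤-trans m≤k (ℕ.≤-trans (ℕ.n≤1+n k) (subst (ℕ._≤ length X) κX (κ≤length X)))

    digits-sandwich : ∀ L j → Sandwich L (suc k) (cyl (digits m j))
    digits-sandwich L j = sandwich L (digits m j) k
      (subst (p′ ℕ.≤_) (sym (length-digits m j)) p′≤m)
      (ℕ.≤-trans (κ≤length (digits m j)) (subst (ℕ._≤ k) (sym (length-digits m j)) m≤k))

    indicator : Str b → ℚ
    indicator X = eq (suc k) (κ X)

    sumOver-cylinders : ∀ L j → sumOver (cylinder (digits m j) L) (λ X → wt X * indicator X) ≡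
                                r * G L (λ Z → indicator (digits m j ++ Z))
    sumOver-cylinders L j = trans (sumOver-cylinder (digits m j) L indicator)
      (cong (_* G L (λ Z → indicator (digits m j ++ Z))) (wt-digits j))

    cylinders : ℕ → ℕ → ℕ → List (Str b)
    cylinders L A C = concat (applyUpTo (λ t → cylinder (digits m (A ℕ.+ t)) L) C)

    -- With L beyond every length in `as`, the truncated cylinders contain the whole list, and each
    -- has mass at most `r * B`. Indices `A + t` beyond b^m only repeat cylinders, which is harmless
    -- for an upper bound.
    mass-upper : ∀ A C as → Unique as → All (λ X → κ X ≡ suc k) as →
      All (λ X → A ℕ.≤ val (take m X) × val (take m X) ℕ.< A ℕ.+ C) as →
      sumOver as wt ≤ ι C * (r * B)
    mass-upper A C as uas κas Aas = begin
      sumOver as wt                                            ≡⟨ with-indicator as κas ⟩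
      sumOver as (λ X → wt X * indicator X)                    ≤⟨ sumOver-⊆ as (cylinders L A C) _ 0≤summand uas as⊆ ⟩
      sumOver (cylinders L A C) (λ X → wt X * indicator X)     ≤⟨ sumOver-concat-≤ _ (r * B) _ C (λ t →
                                                                    ℚ.≤-trans (ℚ.≤-reflexive (sumOver-cylinders L (A ℕ.+ t)))
                                                                    (ℚ.*-monoˡ-≤-nonNeg r {{r-nonNeg}} (proj₁ (digits-sandwich L (A ℕ.+ t))))) ⟩
      ι C * (r * B)                                            ∎
      where
      open ℚ.≤-Reasoning
      bound : List (Str b) → ℕ
      bound []       = 0
      bound (X ∷ Xs) = suc (length X) ℕ.⊔ bound Xs
      L : ℕ
      L = bound as
      <bound : ∀ {X} Xs → X ∈ₗ Xs → length X ℕ.< bound Xs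
      <bound (X ∷ Xs) (here refl) = ℕ.m≤m⊔n (suc (length X)) (bound Xs)
      <bound (Y ∷ Xs) (there X∈)  = ℕ.≤-trans (<bound Xs X∈) (ℕ.m≤n⊔m (suc (length Y)) (bound Xs))
      with-indicator : ∀ as → All (λ X → κ X ≡ suc k) as → sumOver as wt ≡ sumOver as (λ X → wt X * indicator X)
      with-indicator []       []         = refl
      with-indicator (X ∷ as) (κX ∷ κas) = cong₂ _+_
        (sym (trans (cong (wt X *_) (trans (cong (eq (suc k)) κX) (eq-refl (suc k)))) (ℚ.*-identityʳ (wt X))))
        (with-indicator as κas)
      0≤summand : ∀ X → 0ℚ ≤ wt X * indicator X
      0≤summand X = subst (_≤ wt X * indicator X) (ℚ.*-zeroʳ (wt X))
        (ℚ.*-monoˡ-≤-nonNeg (wt X) {{nonNegative (0≤wt X)}} (0≤eq (suc k) (κ X)))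
      as⊆ : ∀ {X} → X ∈ₗ as → X ∈ₗ cylinders L A C
      as⊆ {X} X∈ with All.lookup κas X∈ | All.lookup Aas X∈
      ... | κX | A≤ , <A+C = subst (_∈ₗ cylinders L A C) (List.take++drop≡id m X)
        (Mem.∈-concat⁺′ (Mem.∈-map⁺ (take m X ++_) (words-complete L (drop m X) short))
          (subst (λ Y → cylinder Y L ∈ₗ applyUpTo (λ t → cylinder (digits m (A ℕ.+ t)) L) C) digits≡
            (Mem.∈-applyUpTo⁺ (λ t → cylinder (digits m (A ℕ.+ t)) L)
              (ℕ.+-cancelˡ-< A _ C (subst (ℕ._< A ℕ.+ C) (sym (ℕ.m+[n∸m]≡n A≤)) <A+C)))))
        where
        digits≡ : digits m (A ℕ.+ (val (take m X) ℕ.∸ A)) ≡ take m X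
        digits≡ = trans (cong (digits m) (ℕ.m+[n∸m]≡n A≤))
          (digits-val m (take m X) (length-take-m κX))
        short : length (drop m X) ℕ.< L
        short = ℕ.≤-<-trans (ℕ.≤-trans (ℕ.≤-reflexive (List.length-drop m X)) (ℕ.m∸n≤m (length X) m)) (<bound as X∈)

    cylinders-unique : ∀ L A C → (∀ t → t ℕ.< C → A ℕ.+ t ℕ.< b ℕ.^ m) → Unique (cylinders L A C)
    cylinders-unique L A C <M = Unique.concat⁺
      (All.applyUpTo⁺₂ _ C (λ t → Unique.map⁺ (List.++-cancelˡ (digits m (A ℕ.+ t)) _ _) (words-unique L)))
      (AllPairs.applyUpTo⁺₁ _ C λ {i} {j} i<j j<C {X} → λ { (X∈i , X∈j) → disjoint i<j j<C X∈i X∈j })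
      where
      prefix : ∀ {X} j → X ∈ₗ cylinder (digits m j) L → take m X ≡ digits m j
      prefix j X∈ with Mem.∈-map⁻ (digits m j ++_) X∈
      ... | Z , _ , refl = trans (take-++ m (digits m j) Z (ℕ.≤-reflexive (sym (length-digits m j))))
                                 (List.take-all m (digits m j) (ℕ.≤-reflexive (length-digits m j)))
      disjoint : ∀ {i j X} → i ℕ.< j → j ℕ.< C →
        X ∈ₗ cylinder (digits m (A ℕ.+ i)) L → X ∈ₗ cylinder (digits m (A ℕ.+ j)) L → ⊥
      disjoint {i} {j} {X} i<j j<C X∈i X∈j = ℕ.<⇒≢ (ℕ.+-monoʳ-< A i<j) (begin
        A ℕ.+ i                         ≡⟨ val-digits m (A ℕ.+ i) (<M i (ℕ.<-trans i<j j<C)) ⟨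
        val (digits m (A ℕ.+ i))        ≡⟨ cong val (prefix (A ℕ.+ i) X∈i) ⟨
        val (take m X)                  ≡⟨ cong val (prefix (A ℕ.+ j) X∈j) ⟩
        val (digits m (A ℕ.+ j))        ≡⟨ val-digits m (A ℕ.+ j) (<M j j<C) ⟩
        A ℕ.+ j                         ∎)
        where open ≡-Reasoning

    long : ∃[ L ] (∀ j → B * E L (λ Z → le (suc k ℕ.+ p′) (cyl (digits m j) Z)) ≤ r)
    -- `few-occurrences` bounds L times the probability e by `B * ι c`, which is N, for every prefix
    -- at once. With L = M b^p N this leaves B e at most 1/M = r.
    long = M ℕ.* (b^p ℕ.* N) , λ j → small (E (M ℕ.* (b^p ℕ.* N)) (λ Z → le (suc k ℕ.+ p′) (cyl (digits m j) Z)))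
        (few-occurrences (digits m j) (suc k ℕ.+ p′) (M ℕ.* (b^p ℕ.* N)))
      where
      M b^p c N : ℕ
      M   = b ℕ.^ m
      b^p = b ℕ.^ suc p′
      c   = suc (suc k ℕ.+ p′ ℕ.+ p′)
      N   = b^p ℕ.* c
      instance
        N≢0 : ℕ.NonZero N
        N≢0 = ℕ.m*n≢0 b^p c {{b^-nonZero (suc p′)}}
        N-pos : Positive (ι N)
        N-pos = ι-pos N
      small : ∀ e → ι (M ℕ.* (b^p ℕ.* N)) * e ≤ B * ι c → B * e ≤ r
      small e le = begin
        B * e                           ≡⟨ ℚ.*-identityˡ (B * e) ⟨
        1ℚ * (B * e)                    ≡⟨ cong (_* (B * e)) r*M ⟨
        (r * ι M) * (B * e)             ≡⟨ ℚ.*-assoc r (ι M) (B * e) ⟩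
        r * (ι M * (B * e))             ≤⟨ ℚ.*-monoˡ-≤-nonNeg r {{r-nonNeg}} (ℚ.*-cancelʳ-≤-pos (ι N) (begin
          (ι M * (B * e)) * ι N           ≡⟨ e₁ (ι M) B e (ι N) ⟩
          (ι M * (B * ι N)) * e           ≡⟨ cong (_* e) (trans (cong (ι M *_) (sym (ι-* b^p N))) (sym (ι-* M (b^p ℕ.* N)))) ⟩
          ι (M ℕ.* (b^p ℕ.* N)) * e       ≤⟨ le ⟩
          B * ι c                         ≡⟨ ι-* b^p c ⟨
          ι N                             ≡⟨ ℚ.*-identityˡ (ι N) ⟨
          1ℚ * ι N                        ∎)) ⟩
        r * 1ℚ                          ≡⟨ ℚ.*-identityʳ r ⟩
        r                               ∎
        where
        open ℚ.≤-Reasoning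
        e₁ : ∀ x y z n → (x * (y * z)) * n ≡ (x * (y * n)) * z
        e₁ = solve-∀ ℚ-ring

    -- Truncation costs each cell at most r^2, and at most 1/r cells take part, so the total loss is
    -- at most `r`. Indices below b^m make the cylinders disjoint and the list free of repetitions.
    mass-lower : ∀ A C → C ℕ.≤ b ℕ.^ m → (∀ t → t ℕ.< C → A ℕ.+ t ℕ.< b ℕ.^ m) →
      ∃[ as ] (Unique as × All (λ X → κ X ≡ suc k) as ×
               (∀ {X} → X ∈ₗ as → ∃[ t ] (t ℕ.< C × ∃[ Z ] X ≡ digits m (A ℕ.+ t) ++ Z)) ×
               ι C * (r * B) - r ≤ sumOver as wt)
    mass-lower A C C≤M <M = as
      , Unique.filter⁺ level? (cylinders-unique L A C <M)
      , All.tabulate (λ X∈ → proj₂ (Mem.∈-filter⁻ level? {xs = cylinders L A C} X∈))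
      , (λ X∈ → locate (proj₁ (Mem.∈-filter⁻ level? X∈)))
      , (begin
          ι C * (r * B) - r                                      ≤⟨ ≤-by (e₁ (ι C) r B) (ℚ.*-monoʳ-≤-nonNeg r {{r-nonNeg}} C*r≤1) ⟩
          ι C * (r * (B - r))                                    ≤⟨ sumOver-concat-≥ _ (r * (B - r)) _ C cylinder-≥ ⟩
          sumOver (cylinders L A C) (λ X → wt X * indicator X)   ≡⟨ sumOver-level (cylinders L A C) κ (suc k) wt ⟨
          sumOver as wt                                          ∎)
      where
      open ℚ.≤-Reasoning
      L : ℕ
      L = proj₁ long
      level? : ∀ X → Dec (κ X ≡ suc k)
      level? X = κ X ℕ.≟ suc k
      as : List (Str b)
      as = filter level? (cylinders L A C)
      locate : ∀ {X} → X ∈ₗ cylinders L A C → ∃[ t ] (t ℕ.< C × ∃[ Z ] X ≡ digits m (A ℕ.+ t) ++ Z)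
      locate X∈ with Mem.∈-concat⁻′ (applyUpTo (λ t → cylinder (digits m (A ℕ.+ t)) L) C) X∈
      ... | _ , X∈cyl , cyl∈ with Mem.∈-applyUpTo⁻ (λ t → cylinder (digits m (A ℕ.+ t)) L) cyl∈
      ... | t , t<C , refl with Mem.∈-map⁻ (digits m (A ℕ.+ t) ++_) X∈cyl
      ... | Z , _ , X≡ = t , t<C , Z , X≡
      C*r≤1 : ι C * r ≤ 1ℚ
      C*r≤1 = ℚ.≤-trans (ℚ.*-monoʳ-≤-nonNeg r {{r-nonNeg}} (ι-mono-≤ C≤M)) (ℚ.≤-reflexive (trans (ℚ.*-comm _ r) r*M))
      e₁ : ∀ c r B → 1ℚ * r - (c * r) * r ≡ c * (r * (B - r)) - (c * (r * B) - r)
      e₁ = solve-∀ ℚ-ring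
      cylinder-≥ : ∀ t → r * (B - r) ≤ sumOver (cylinder (digits m (A ℕ.+ t)) L) (λ X → wt X * indicator X)
      cylinder-≥ t = ℚ.≤-trans (ℚ.*-monoˡ-≤-nonNeg r {{r-nonNeg}} (≤-by (e₂ g B r)
          (ℚ.≤-trans (proj₂ (digits-sandwich L j)) (ℚ.+-monoʳ-≤ g (proj₂ long j)))))
        (ℚ.≤-reflexive (sym (sumOver-cylinders L j)))
        where
        j = A ℕ.+ t
        g = G L (λ Z → indicator (digits m j ++ Z))
        e₂ : ∀ g B r → (g + r) - B ≡ g - (B - r)
        e₂ = solve-∀ ℚ-ring

-- Choice of the mesh, and the squeeze of the interval.

infixr 5 _⊕_ _⊕≤_

_⊕_ : ∀ {a b c d} → a < b → c < d → a + c < b + d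
_⊕_ = ℚ.+-mono-<

_⊕≤_ : ∀ {a b c d} → a < b → c ≤ d → a + c < b + d
_⊕≤_ = ℚ.+-mono-<-≤

<-drop-gap : ∀ {p q ε} → 0ℚ < ε → p + ε < q → p < q
<-drop-gap {p} {q} {ε} 0<ε p+ε<q = <-by (e p q ε) (p+ε<q ⊕ 0<ε)
  where
  e : ∀ p q ε → (q + ε) - ((p + ε) + 0ℚ) ≡ q - p
  e = solve-∀ ℚ-ring

fine-level : ∀ b .{{_ : NonTrivial b}} n c ε → 0ℚ < ε → ∃[ m ] (n ℕ.≤ m × ι 16 * (_/b^_ b 1 m * ι c) ≤ ε)
fine-level b n c ε 0<ε = from-archimedean (archimedean ε 0<ε)
  where
  open ℚ.≤-Reasoning
  e₁ : ∀ a r c → a * (r * c) ≡ (a * c) * 1ℚ * r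
  e₁ = solve-∀ ℚ-ring
  e₂ : ∀ a ε d r → a * (ε * d) * r ≡ ε * (a * d) * r
  e₂ = solve-∀ ℚ-ring
  e₃ : ∀ ε M r → ε * M * r ≡ ε * (r * M)
  e₃ = solve-∀ ℚ-ring
  from-archimedean : ∃[ d ] 1ℚ ≤ ε * ι d → ∃[ m ] (n ℕ.≤ m × ι 16 * (_/b^_ b 1 m * ι c) ≤ ε)
  from-archimedean (d , 1≤εd) = m , ℕ.m≤m+n n a , (begin
    ι 16 * (r * ι c)            ≡⟨ e₁ (ι 16) r (ι c) ⟩
    (ι 16 * ι c) * 1ℚ * r       ≡⟨ cong (λ x → x * 1ℚ * r) (ι-* 16 c) ⟨
    ι (16 ℕ.* c) * 1ℚ * r       ≤⟨ *r (ℚ.*-monoˡ-≤-nonNeg (ι (16 ℕ.* c)) {{ι-nonNeg (16 ℕ.* c)}} 1≤εd) ⟩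
    ι (16 ℕ.* c) * (ε * ι d) * r ≡⟨ e₂ (ι (16 ℕ.* c)) ε (ι d) r ⟩
    ε * (ι (16 ℕ.* c) * ι d) * r ≡⟨ cong (λ x → ε * x * r) (ι-* (16 ℕ.* c) d) ⟨
    ε * ι a * r                 ≤⟨ *r (ℚ.*-monoˡ-≤-nonNeg ε {{nonNegative (ℚ.<⇒≤ 0<ε)}} (ι-mono-≤ (ℕ.≤-trans (ℕ.m≤n+m a n) (ℕ.<⇒≤ (m<b^m b m))))) ⟩
    ε * ι (b ^ m) * r           ≡⟨ e₃ ε (ι (b ^ m)) r ⟩
    ε * (r * ι (b ^ m))         ≡⟨ cong (ε *_) (/-*-cancel 1 (b ^ m) {{b^m≢0}}) ⟩
    ε * 1ℚ                      ≡⟨ ℚ.*-identityʳ ε ⟩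
    ε                           ∎)
    where
    a m : ℕ
    -- Since `ε * ι d` is at least 1, it suffices that b^m be at least 16 c d, and b^m exceeds `m`.
    a = 16 ℕ.* c ℕ.* d
    m = n ℕ.+ a
    r : ℚ
    r = _/b^_ b 1 m
    b^m≢0 : ℕ.NonZero (b ^ m)
    b^m≢0 = ℕ.m^n≢0 b m {{nonTrivial⇒nonZero b}}
    *r : ∀ {x y} → x ≤ y → x * r ≤ y * r
    *r = ℚ.*-monoʳ-≤-nonNeg r {{ℚ.normalize-nonNeg 1 (b ^ m) {{b^m≢0}}}}

<ᴿ⇒eventually-< : ∀ {x y} → x <ᴿ y → Eventually (λ n → seq x n < seq y n)
<ᴿ⇒eventually-< (ε , 0<ε , x+ε<y) = eventually-map (<-drop-gap 0<ε) x+ε<y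

module Limit (b : ℕ) .{{b>1 : NonTrivial b}} {p″ : ℕ} (w₀ : Fin b) (v : Vec (Fin b) p″)
             (I : Pred ℝ 0ℓ) (interval : IsInterval I) (unit : WithinUnit I)
             (s i : ℝ) (sup : IsSup I s) (inf : IsInf I i) (ε : ℚ)
             (m : ℕ) (p′≤m : length (toList v) ℕ.≤ m)
             (16θ≤ε : ι 16 * (_/b^_ b 1 m * ι (b ^ suc (length (toList v)))) ≤ ε) where
  open Mean b
  open Count w₀ (toList v)
  open Strings b
  open Mass b w₀ (toList v) m
  open Grid r 0<r (b ^ m) r*M using (h; h>0; Near; near; <-from-grid)

  occ≡κ : ∀ X → occurrences b (w₀ Vec.∷ v) X ≡ κ X
  occ≡κ = occurrences≡κ w₀ (toList v) (w₀ Vec.∷ v) (cong suc (sym (Vec.length-toList v))) refl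

  -- The limiting mass of one cell, the unit in which all errors are measured.
  θ : ℚ
  θ = r * B

  ε≥16θ : ι 16 * θ ≤ ε
  ε≥16θ = subst (λ x → ι 16 * (x * B) ≤ ε) (sym r≡) 16θ≤ε

  r≤θ : r ≤ θ
  r≤θ = subst (_≤ θ) (ℚ.*-identityʳ r)
    (ℚ.*-monoˡ-≤-nonNeg r {{r-nonNeg}} (ι-mono-≤ {1} (ℕ.≤-trans (s≤s z≤n) (m<b^m b (suc p′)))))

  0<θ : 0ℚ < θ
  0<θ = ℚ.<-≤-trans 0<r r≤θ

  -- The supremum may lie outside I, while convexity needs an element of I.
  near-sup : ∃[ z ] (z ∈ I × s -ᴿ fromℚ r <ᴿ z)
  near-sup = proj₂ sup (s -ᴿ fromℚ r) (h , h>0 , 0 , λ n _ → <-by (e (seq s n) r) h>0)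
    where
    e : ∀ s r → ½ * r - 0ℚ ≡ s - ((s - r) + ½ * r)
    e = solve-∀ ℚ-ring

  near-inf : ∃[ x ] (x ∈ I × x <ᴿ i +ᴿ fromℚ r)
  near-inf = proj₂ inf (i +ᴿ fromℚ r) (h , h>0 , 0 , λ n _ → <-by (e (seq i n) r) h>0)
    where
    e : ∀ i r → ½ * r - 0ℚ ≡ (i + r) - (i + ½ * r)
    e = solve-∀ ℚ-ring

  opaque
    x z : ℝ
    x = proj₁ near-inf
    z = proj₁ near-sup

    x∈I : x ∈ I
    x∈I = proj₁ (proj₂ near-inf)

    z∈I : z ∈ I
    z∈I = proj₁ (proj₂ near-sup)

    x<ᴿi+r : x <ᴿ i +ᴿ fromℚ r
    x<ᴿi+r = proj₂ (proj₂ near-inf)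

    s-r<ᴿz : s -ᴿ fromℚ r <ᴿ z
    s-r<ᴿz = proj₂ (proj₂ near-sup)

  s-r<z : Eventually (λ n → seq s n - r < seq z n)
  s-r<z = <ᴿ⇒eventually-< {s -ᴿ fromℚ r} {z} s-r<ᴿz

  x<i+r : Eventually (λ n → seq x n < seq i n + r)
  x<i+r = <ᴿ⇒eventually-< {x} {i +ᴿ fromℚ r} x<ᴿi+r

  z<1 : Eventually (λ n → seq z n < 1ℚ)
  z<1 = <ᴿ⇒eventually-< {z} {fromℚ 1ℚ} (proj₂ (unit z∈I))

  i<z+r : Eventually (λ n → seq i n < seq z n + r)
  i<z+r = proj₁ inf z∈I r 0<r

  i-near : ∃[ u ] Near i u
  i-near = near i (-r<i & eventually-map i<1+r (i<z+r & z<1))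
    where
    e₁ : ∀ x i r ε′ → ((x + ε′) + (i + r)) - (0ℚ + (x + ε′)) ≡ i - - r
    e₁ = solve-∀ ℚ-ring
    -r<inf : x <ᴿ i +ᴿ fromℚ r → Eventually (λ n → - r < seq i n)
    -r<inf (ε′ , 0<ε′ , x+ε′<i+r) =
      eventually-map (λ { {n} (0<x+ε′ , x+ε′<i+r) → <-by (e₁ (seq x n) (seq i n) r ε′) (0<x+ε′ ⊕ x+ε′<i+r) })
        (proj₁ (unit x∈I) ε′ 0<ε′ & x+ε′<i+r)
    -r<i : Eventually (λ n → - r < seq i n)
    -r<i = -r<inf x<ᴿi+r
    e₂ : ∀ i z r → ((z + r) + 1ℚ) - (i + z) ≡ (1ℚ + r) - i
    e₂ = solve-∀ ℚ-ring
    i<1+r : ∀ {n} → seq i n < seq z n + r × seq z n < 1ℚ → seq i n < 1ℚ + r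
    i<1+r {n} (i<z+r , z<1) = <-by (e₂ (seq i n) (seq z n) r) (i<z+r ⊕ z<1)

  s-near : ∃[ u ] Near s u
  s-near = near s (-r<s & eventually-map s<1+r (s-r<z & z<1))
    where
    e₁ : ∀ z s r → ((z + ½ * r) + (s + ½ * r)) - (0ℚ + z) ≡ s - - r
    e₁ = solve-∀ ℚ-ring
    -r<s : Eventually (λ n → - r < seq s n)
    -r<s = eventually-map (λ { {n} (0≤z , z≤s) → <-by (e₁ (seq z n) (seq s n) r) (0≤z ⊕ z≤s) })
      (proj₁ (unit z∈I) h h>0 & proj₁ sup z∈I h h>0)
    e₂ : ∀ s z r → (z + 1ℚ) - ((s - r) + z) ≡ (1ℚ + r) - s
    e₂ = solve-∀ ℚ-ring
    s<1+r : ∀ {n} → seq s n - r < seq z n × seq z n < 1ℚ → seq s n < 1ℚ + r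
    s<1+r {n} (s-r<z , z<1) = <-by (e₂ (seq s n) (seq z n) r) (s-r<z ⊕ z<1)

  opaque
    U V : ℕ
    U = proj₁ i-near
    V = proj₁ s-near

    i≈U : Near i U
    i≈U = proj₂ i-near

    s≈V : Near s V
    s≈V = proj₂ s-near

  -- Locating `i` and `s` costs two cells each, and comparing them through `z` costs one mesh width
  -- on either side.
  U<V+6 : U ℕ.< V ℕ.+ 6
  U<V+6 = <-from-grid 6 (always (eventually-map
    (λ { {n} ((U<i , _) , (_ , s<V) , i<z , z<s) → <-by (e (ι U) (ι V) (seq i n) (seq z n) (seq s n) r) (U<i ⊕ s<V ⊕ i<z ⊕ z<s) })
    (i≈U & s≈V & i<z+r & proj₁ sup z∈I r 0<r)))
    where
    e : ∀ u v i z s r →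
      (i + ((v + ι 2) * r + ((z + r) + (s + r)))) - ((u - ι 2) * r + (s + (i + z))) ≡ (v + ι 6) * r - u * r
    e = solve-∀ ℚ-ring

  V∸3≤M : V ℕ.∸ 3 ℕ.≤ b ℕ.^ m
  V∸3≤M = ℕ.m≤n+o⇒m∸n≤o V 3 (subst (V ℕ.≤_) (ℕ.+-comm (b ℕ.^ m) 3) (ℕ.<⇒≤ (<-from-grid 3 (always (eventually-map
    (λ { {n} ((V<s , _) , s<z , z<1) → <-by (e (ι V) (seq s n) (seq z n) r (ι (b ℕ.^ m)))
           (V<s ⊕ s<z ⊕ subst (seq z n <_) (sym (trans (ℚ.*-comm _ r) r*M)) z<1) })
    (s≈V & s-r<z & z<1))))))
    where
    e : ∀ v s z r M → (s + (z + M * r)) - ((v - ι 2) * r + ((s - r) + z)) ≡ (M + ι 3) * r - v * r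
    e = solve-∀ ℚ-ring

  module _ (k : ℕ) (m≤k : m ℕ.≤ k) where

    upper : ∀ q → q ∈ below (μ b (w₀ Vec.∷ v) (suc k) I) → fromℚ q ≤ᴿ B · (s -ᴿ i) +ᴿ fromℚ ε
    upper q (as , uas , Pas , q<Σ) ε′ 0<ε′ = eventually-map
      -- The excess over B (s - i) is 10θ: six from C + U ≤ V + 6 and four from locating `i` and
      -- `s`. The other 6θ of the available 16θ are discarded.
      (λ { {n} ((_ , i<U) , V<s , _) → <-by (e q (sumOver as wt) (ι C) r B (ι U) (ι V) (seq s n) (seq i n) ε ε′)
         (q<Σ ⊕≤ ℚ.+-mono-≤ Σ≤ (ℚ.+-mono-≤ Cθ≤ (ℚ.+-mono-≤ (*B (ℚ.<⇒≤ (V<s ⊕ i<U))) (ℚ.+-mono-≤ ε≥16θ (ℚ.+-mono-≤ 0≤6θ (ℚ.<⇒≤ 0<ε′)))))) })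
      (i≈U & s≈V)
      where
      A C : ℕ
      -- The range is widened by three cells at each end: two for locating the end point and one for
      -- the tolerance `r` in comparing it with a point of I.
      A = U ℕ.∸ 3
      C = (V ℕ.+ 3) ℕ.∸ A
      κas : All (λ X → κ X ≡ suc k) as
      κas = All.map (λ {X} P → trans (sym (occ≡κ X)) (proj₁ P)) Pas
      in-range : ∀ {X} → occurrences b (w₀ Vec.∷ v) X ≡ suc k × fromℚ (loc X) ∈ I →
                 A ℕ.≤ val (take m X) × val (take m X) ℕ.< A ℕ.+ C
      in-range {X} (occ≡k , X∈I) =
          ℕ.m≤n+o⇒m∸n≤o U 3 (subst (U ℕ.≤_) (ℕ.+-comm j 3) (ℕ.≤-pred (subst (U ℕ.<_) (ℕ.+-suc j 3) U<j+4)))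
        , ℕ.<-≤-trans j<V+3 (ℕ.m≤n+m∸n (V ℕ.+ 3) A)
        where
        j = val (take m X)
        |Y|≡m : length (take m X) ≡ m
        |Y|≡m = length-take-m p′≤m k m≤k (trans (sym (occ≡κ X)) occ≡k)
        jr≤loc : ι j * r ≤ loc X
        jr≤loc = subst (λ X → ι j * r ≤ loc X) (List.take++drop≡id m X) (loc-≥ (take m X) (drop m X) |Y|≡m)
        loc≤[j+1]r : loc X ≤ (ι j + 1ℚ) * r
        loc≤[j+1]r = subst (λ X → loc X ≤ (ι j + 1ℚ) * r) (List.take++drop≡id m X) (loc-≤ (take m X) (drop m X) |Y|≡m)
        e₁ : ∀ u j i l r → (i + ((l + r) + (j + 1ℚ) * r)) - ((u - ι 2) * r + (i + l)) ≡ (j + ι 4) * r - u * r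
        e₁ = solve-∀ ℚ-ring
        e₂ : ∀ v j s l r → ((s + r) + ((v + ι 2) * r + l)) - (l + (s + j * r)) ≡ (v + ι 3) * r - j * r
        e₂ = solve-∀ ℚ-ring
        U<j+4 : U ℕ.< j ℕ.+ 4
        U<j+4 = <-from-grid 4 (always (eventually-map
          (λ { {n} ((U<i , _) , i<X) → <-by (e₁ (ι U) (ι j) (seq i n) (loc X) r) (U<i ⊕ i<X ⊕≤ loc≤[j+1]r) })
          (i≈U & proj₁ inf X∈I r 0<r)))
        j<V+3 : j ℕ.< V ℕ.+ 3
        j<V+3 = <-from-grid 3 (always (eventually-map
          (λ { {n} ((_ , s<V) , X<s) → <-by (e₂ (ι V) (ι j) (seq s n) (loc X) r) (X<s ⊕ s<V ⊕≤ jr≤loc) })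
          (s≈V & proj₁ sup X∈I r 0<r)))
      Σ≤ : sumOver as wt ≤ ι C * θ
      Σ≤ = mass-upper p′≤m k m≤k A C as uas κas (All.map in-range Pas)
      C+U≤V+6 : C ℕ.+ U ℕ.≤ V ℕ.+ 6
      C+U≤V+6 = begin
        C ℕ.+ U                   ≤⟨ ℕ.+-monoʳ-≤ C (ℕ.m≤n+m∸n U 3) ⟩
        C ℕ.+ (3 ℕ.+ A)           ≡⟨ e′ C A ⟩
        C ℕ.+ A ℕ.+ 3             ≡⟨ cong (ℕ._+ 3) (ℕ.m∸n+n≡m A≤V+3) ⟩
        V ℕ.+ 3 ℕ.+ 3             ≡⟨ ℕ.+-assoc V 3 3 ⟩
        V ℕ.+ 6                   ∎
        where
        open ℕ.≤-Reasoning
        e′ : ∀ c a → c ℕ.+ (3 ℕ.+ a) ≡ c ℕ.+ a ℕ.+ 3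
        e′ = ℕ-Solver.solve-∀
        A≤V+3 : A ℕ.≤ V ℕ.+ 3
        A≤V+3 = ℕ.m≤n+o⇒m∸n≤o U 3 (subst (U ℕ.≤_) (e″ V) (ℕ.<⇒≤ U<V+6))
          where
          e″ : ∀ v → v ℕ.+ 6 ≡ 3 ℕ.+ (v ℕ.+ 3)
          e″ = ℕ-Solver.solve-∀
      Cθ≤ : (ι C + ι U) * θ ≤ (ι V + ι 6) * θ
      Cθ≤ = ℚ.*-monoʳ-≤-nonNeg θ {{nonNegative (ℚ.<⇒≤ 0<θ)}} (subst₂ _≤_ (ι-+ C U) (ι-+ V 6) (ι-mono-≤ C+U≤V+6))
      *B : ∀ {x y} → x ≤ y → B * x ≤ B * y
      *B = ℚ.*-monoˡ-≤-nonNeg B {{B-nonNeg}}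
      0≤6θ : ι 6 * 0ℚ ≤ ι 6 * θ
      0≤6θ = ℚ.*-monoˡ-≤-nonNeg (ι 6) (ℚ.<⇒≤ 0<θ)
      e : ∀ q S c r B u v s i ε ε′ →
        (S + (c * (r * B) + ((v + ι 6) * (r * B) + (B * (s + (u + ι 2) * r) + (ε + (ι 6 * (r * B) + ε′))))))
        - (q + (S + ((c + u) * (r * B) + (B * ((v - ι 2) * r + i) + (ι 16 * (r * B) + (ι 6 * 0ℚ + 0ℚ))))))
        ≡ ((B * (s - i) + ε) + ε′) - q
      e = solve-∀ ℚ-ring

    lower : ∃[ q ] (q ∈ below (μ b (w₀ Vec.∷ v) (suc k) I) × B · (s -ᴿ i) -ᴿ fromℚ ε <ᴿ fromℚ q)
    lower = build (mass-lower p′≤m k m≤k A C C≤M A+t<M)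
      where
      A C : ℕ
      -- The range is narrowed by three cells at each end: two for locating the end point and one
      -- for the distance to `x` or `z`. If nothing is left, `C` is 0 and `q` is negative, and the
      -- estimate still holds.
      A = U ℕ.+ 3
      C = (V ℕ.∸ 3) ℕ.∸ A
      C≤M : C ℕ.≤ b ℕ.^ m
      C≤M = ℕ.≤-trans (ℕ.m∸n≤m (V ℕ.∸ 3) A) V∸3≤M
      A+t<V∸3 : ∀ t → t ℕ.< C → A ℕ.+ t ℕ.< V ℕ.∸ 3
      A+t<V∸3 t t<C = ℕ.≰⇒> λ V∸3≤A+t → ℕ.<⇒≱ t<C (ℕ.m≤n+o⇒m∸n≤o (V ℕ.∸ 3) A V∸3≤A+t)
      A+t<M : ∀ t → t ℕ.< C → A ℕ.+ t ℕ.< b ℕ.^ m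
      A+t<M t t<C = ℕ.<-≤-trans (A+t<V∸3 t t<C) V∸3≤M
      q : ℚ
      -- One θ absorbs the truncation loss `r`, the other makes the inequality with the sum strict.
      q = ι C * θ - ι 2 * θ

      -- The cell lies between two elements of I: x < i + r < (U + 3) r ≤ j r, and (j + 1) r ≤ (V -
      -- 3) r < s - r < z.
      inside : ∀ j → A ℕ.≤ j → j ℕ.< V ℕ.∸ 3 → ∀ Z → fromℚ (loc (digits m j ++ Z)) ∈ I
      inside j A≤j j<V∸3 Z = interval x∈I z∈I
        (λ ε′ 0<ε′ → eventually-map
          (λ { {n} (x<i , _ , i<U) → <-by (e₁ (seq x n) (seq i n) (ι U) (ι j) l r ε′)
            (x<i ⊕ i<U ⊕ 0<ε′ ⊕≤ ℚ.+-mono-≤ (*r (subst (_≤ ι j) (ι-+ U 3) (ι-mono-≤ A≤j))) jr≤l) })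
          (x<i+r & i≈U))
        (λ ε′ 0<ε′ → eventually-map
          (λ { {n} (s<z , V<s , _) → <-by (e₂ (seq z n) (seq s n) (ι V) (ι j) l r ε′)
            (s<z ⊕ V<s ⊕ 0<ε′ ⊕≤ ℚ.+-mono-≤ (*r (subst (_≤ ι V) (ι-+ j 4) (ι-mono-≤ j+4≤V))) l≤[j+1]r) })
          (s-r<z & s≈V))
        where
        l : ℚ
        l = loc (digits m j ++ Z)
        *r : ∀ {x y} → x ≤ y → x * r ≤ y * r
        *r = ℚ.*-monoʳ-≤-nonNeg r {{r-nonNeg}}
        val≡j : val (digits m j) ≡ j
        val≡j = val-digits m j (ℕ.<-≤-trans j<V∸3 V∸3≤M)
        jr≤l : ι j * r ≤ l
        jr≤l = subst (λ j′ → ι j′ * r ≤ l) val≡j (loc-≥ (digits m j) Z (length-digits m j))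
        l≤[j+1]r : l ≤ (ι j + 1ℚ) * r
        l≤[j+1]r = subst (λ j′ → l ≤ (ι j′ + 1ℚ) * r) val≡j (loc-≤ (digits m j) Z (length-digits m j))
        j+4≤V : j ℕ.+ 4 ℕ.≤ V
        j+4≤V = subst (ℕ._≤ V) (sym (ℕ.+-suc j 3)) (ℕ.m≤o∸n⇒m+n≤o (suc j) (3≤V V j<V∸3) j<V∸3)
          where
          3≤V : ∀ V → j ℕ.< V ℕ.∸ 3 → 3 ℕ.≤ V
          3≤V V j<V∸3 = ℕ.<⇒≤ (ℕ.m∸n≢0⇒n<m {V} {3} λ V∸3≡0 → ℕ.n≮0 (subst (j ℕ.<_) V∸3≡0 j<V∸3))
        e₁ : ∀ x i u j l r ε′ →
          ((i + r) + ((u + ι 2) * r + (ε′ + (j * r + l)))) - (x + (i + (0ℚ + ((u + ι 3) * r + j * r)))) ≡ (l + ε′) - x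
        e₁ = solve-∀ ℚ-ring
        e₂ : ∀ z s v j l r ε′ →
          (z + (s + (ε′ + (v * r + (j + 1ℚ) * r)))) - ((s - r) + ((v - ι 2) * r + (0ℚ + ((j + ι 4) * r + l)))) ≡ (z + ε′) - l
        e₂ = solve-∀ ℚ-ring

      V≤C+U+6 : V ℕ.≤ C ℕ.+ U ℕ.+ 6
      V≤C+U+6 = begin
        V                         ≤⟨ ℕ.m≤n+m∸n V 3 ⟩
        3 ℕ.+ (V ℕ.∸ 3)           ≤⟨ ℕ.+-monoʳ-≤ 3 (ℕ.m≤n+m∸n (V ℕ.∸ 3) A) ⟩
        3 ℕ.+ (U ℕ.+ 3 ℕ.+ C)     ≡⟨ e′ U C ⟩
        C ℕ.+ U ℕ.+ 6             ∎
        where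
        open ℕ.≤-Reasoning
        e′ : ∀ u c → 3 ℕ.+ (u ℕ.+ 3 ℕ.+ c) ≡ c ℕ.+ u ℕ.+ 6
        e′ = ℕ-Solver.solve-∀

      Vθ≤ : ι V * θ ≤ ((ι C + ι U) + ι 6) * θ
      Vθ≤ = ℚ.*-monoʳ-≤-nonNeg θ {{nonNegative (ℚ.<⇒≤ 0<θ)}}
        (subst (ι V ≤_) (trans (ι-+ (C ℕ.+ U) 6) (cong (_+ ι 6) (ι-+ C U))) (ι-mono-≤ V≤C+U+6))

      *B : ∀ {x y} → x ≤ y → B * x ≤ B * y
      *B = ℚ.*-monoˡ-≤-nonNeg B {{B-nonNeg}}

      0<3θ : ι 3 * 0ℚ < ι 3 * θ
      0<3θ = ℚ.*-monoʳ-<-pos (ι 3) 0<θ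

      e : ∀ c r B u v s i ε →
        (ι 3 * (r * B) + (B * ((v + ι 2) * r + i) + (((c + u) + ι 6) * (r * B) + ε)))
        - (ι 3 * 0ℚ + (B * (s + (u - ι 2) * r) + (v * (r * B) + ι 16 * (r * B))))
        ≡ (c * (r * B) - ι 2 * (r * B)) - (((B * (s - i)) - ε) + r * B)
      e = solve-∀ ℚ-ring

      build : ∃[ as ] (Unique as × All (λ X → κ X ≡ suc k) as ×
               (∀ {X} → X ∈ₗ as → ∃[ t ] (t ℕ.< C × ∃[ Z ] X ≡ digits m (A ℕ.+ t) ++ Z)) ×
               ι C * θ - r ≤ sumOver as wt) →
              ∃[ q ] (q ∈ below (μ b (w₀ Vec.∷ v) (suc k) I) × B · (s -ᴿ i) -ᴿ fromℚ ε <ᴿ fromℚ q)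
      build (as , uas , κas , located , Σ≥) = q
        , (as , uas , All.tabulate (λ {X} X∈ → trans (occ≡κ X) (All.lookup κas X∈) , as⊆I X∈) , q<Σ)
        -- The 16θ are spent as follows: six on lost cells, four on locating `i` and `s`, two in
        -- `q`, one on the gap that `<ᴿ` demands, and three on strictness.
        , θ , 0<θ , eventually-map
            (λ { {n} ((U<i , _) , _ , s<V) → <-by (e (ι C) r B (ι U) (ι V) (seq s n) (seq i n) ε)
              (0<3θ ⊕≤ ℚ.+-mono-≤ (*B (ℚ.<⇒≤ (s<V ⊕ U<i))) (ℚ.+-mono-≤ Vθ≤ ε≥16θ)) })
            (i≈U & s≈V)
        where
        as⊆I : ∀ {X} → X ∈ₗ as → fromℚ (loc X) ∈ I
        as⊆I X∈ with t , t<C , Z , refl ← located X∈ = inside (A ℕ.+ t) (ℕ.m≤m+n A t) (A+t<V∸3 t t<C) Z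
        e₂ : ∀ c r B S → (r * B + (r * B + S)) - (0ℚ + (r + (c * (r * B) - r))) ≡ S - (c * (r * B) - ι 2 * (r * B))
        e₂ = solve-∀ ℚ-ring
        q<Σ : q < sumOver as wt
        q<Σ = <-by (e₂ (ι C) r B (sumOver as wt)) (0<θ ⊕≤ ℚ.+-mono-≤ r≤θ Σ≥)

theorem2 : (b : ℕ) .{{_ : NonTrivial b}} (p : ℕ) .{{_ : NonZero p}} (w : Vec (Fin b) p) →
    (I : Pred ℝ 0ℓ) → IsInterval I → WithinUnit I →
    (s i : ℝ) → IsSup I s → IsInf I i →
    (λ k → μ b w k I) ⟶ ((+ (b ^ p) / 1) · (s -ᴿ i))
theorem2 b zero {{p≢0}} w = contradiction refl (ℕ.≢-nonZero⁻¹ 0 {{p≢0}})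
theorem2 b (suc p) (w₀ Vec.∷ v) I interval unit s i sup inf =
  subst (λ n → (λ k → μ b (w₀ Vec.∷ v) k I) ⟶ (ι (b ^ suc n) · (s -ᴿ i))) (Vec.length-toList v)
    λ ε 0<ε → let m , p′≤m , 16θ≤ε = fine-level b (length (toList v)) (b ^ suc (length (toList v))) ε 0<ε
                  open Limit b w₀ v I interval unit s i sup inf ε m p′≤m 16θ≤ε
              -- A prefix of length `m` holds at most `m` occurrences, so from level m + 1 on the
              -- level is still ahead of every prefix.
              in suc m , λ { (suc k) (s≤s m≤k) → lower k m≤k , upper k m≤k }
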